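{- Let $H$ be a non-critical, prime, 3-uniform hypergraph. Consider a vertex $x$ of $H$ such that $H-x$ is prime, and suppose that $H-x$ admits a realization $T_x$. Then $H$ is realizable if and only if the following two assertions hold. (M1) There exists a bipartition $\{X^-,X^+\}$ of $V_x\setminus I_x$ satisfying: - for each component $C$ of the graph $G_x$ with $v(C)\geq 2$, $C$ is bipartite with bipartition $\{X^-\cap V(C),X^+\cap V(C)\}$; - for all $v^-\in X^-$ and $v^+\in X^+$, $v^-v^+\in E(G_x)$ if and only if $v^-v^+\in A(T_x)$. (M2) For this bipartition $\{X^-,X^+\}$ and the associated sets $Y^-,Y^+$ (defined in the context), we have $Y^-\cap Y^+=\emptyset$ and $Y^-\cup Y^+=I_x$. Furthermore, for all $x^-\in X^-$, $x^+\in X^+$, $y^-\in Y^-$ and $y^+\in Y^+$, we have $y^+x^-,\,x^+y^-,\,y^+y^-\in A(T_x)$. Moreover, if $H$ is realizable, then there exists a unique realization $T$ of $H$ such that $T-x=T_x$. Precisely, if $T$ is a realization of $H$ such that $T-x=T_x$, then for all $x^-\in X^-$, $x^+\in X^+$, $y^-\in Y^-$ and $y^+\in Y^+$, we have $xx^-,\,x^+x,\,xy^-,\,y^+x\in A(T)$.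
   Context: All structures are finite. A 3-uniform hypergraph $H$ consists of a vertex set $V(H)$ and an edge set $E(H)\subseteq\binom{V(H)}{3}$. For $v\in V(H)$, $H-v$ is the subhypergraph of $H$ induced by $V(H)\setminus\{v\}$; similarly $T-v$ for a tournament $T$. In a tournament $T$ with arc set $A(T)$, for distinct vertices $v,w$ exactly one of $vw$ (arc from $v$ to $w$), $wv$ belongs to $A(T)$. A subset $M$ of $V(H)$ is a module of $H$ if for each $e\in E(H)$ such that $e\cap M\neq\emptyset$ and $e\setminus M\neq\emptyset$, there exists $m\in M$ such that $e\cap M=\{m\}$ and for every $n\in M$, $(e\setminus\{m\})\cup\{n\}\in E(H)$. The sets $\emptyset$, $V(H)$ and $\{v\}$ ($v\in V(H)$) are modules, called trivial. $H$ is decomposable if it has a nontrivial module; $H$ is prime if $|V(H)|\geq 3$ and all its modules are trivial. A prime $H$ is critical if $H-v$ is decomposable for every $v\in V(H)$. A 3-cycle is a tournament on three vertices isomorphic to $(\{0,1,2\},\{01,12,20\})$. The $C_3$-structure $C_3(T)$ of a tournament $T$ is the 3-uniform hypergraph on $V(T)$ whose edges are the 3-element subsets $X$ of $V(T)$ such that $T[X]$ is a 3-cycle. A tournament $T$ with $V(T)=V(H)$ is a realization of $H$ if $H=C_3(T)$; $H$ is realizable if it admits a realization. For a vertex $x$ of $H$: $V_x=V(H)\setminus\{x\}$; $G_x$ is the graph on $V_x$ in which distinct $v,w$ are adjacent iff $\{x,v,w\}\in E(H)$; $I_x$ is the set of isolated vertices of $G_x$. A component of $G_x$ is a maximal connected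 (induced) subgraph $C$, and $v(C)=|V(C)|$. Given a realization $T_x$ of $H-x$ and a bipartition of $V_x\setminus I_x$ whose two blocks are denoted $X^-$ and $X^+$: $Y^-$ is the set of $v\in I_x$ for which there exists a sequence $v_0,\ldots,v_n$ with $v_0\in X^-$, $v_n=v$, $v_1,\ldots,v_n\in I_x$, and $v_iv_{i+1}\in A(T_x)$ for $i=0,\ldots,n-1$. Dually, $Y^+$ is the set of $v\in I_x$ for which there exists a sequence $v_0,\ldots,v_n$ with $v_0\in X^+$, $v_n=v$, $v_1,\ldots,v_n\in I_x$, and $v_{i+1}v_i\in A(T_x)$ for $i=0,\ldots,n-1$. In the "Moreover" part, $X^-,X^+,Y^-,Y^+$ are the sets provided by (M1) and (M2). -}

module Defs where

open import Data.Fin using (Fin; zero; suc; fromℕ; inject₁)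
open import Data.Fin.Properties using (any?; all?; _≟_)
open import Data.Fin.Subset
  using (Subset; ⊥; ⁅_⁆; _∈_; _⊆_; _∩_; _∪_; _─_; _-_; ∣_∣; Nonempty; Empty)
open import Data.Fin.Subset.Properties using (_∈?_; _⊆?_; p─q⊆p)
open import Data.Nat as ℕ using (ℕ; suc; _≤_)
open import Data.Product using (Σ; Σ-syntax; ∃; ∃-syntax; _×_; _,_; proj₁; proj₂; map₂)
open import Data.Sum using (_⊎_; inj₁; inj₂)
open import Data.Vec.Functional using ([]; _∷_)
open import Function using (Injective; Equivalence; mk⇔; _⇔_; _∘_)
open import Level using (0ℓ)
open import Relation.Binary using (Rel) renaming (_⇔_ to _⇔ᴿ_)
open import Relation.Binary.Construct.Closure.ReflexiveTransitive using (Star)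
open import Relation.Binary.PropositionalEquality
  using (_≡_; _≢_; refl; sym; trans; subst; subst₂)
open import Relation.Nullary using (¬_; Dec; yes; no)
open import Relation.Nullary.Decidable using (map′; _×-dec_; _→-dec_)
import Relation.Unary as U
open U using (Pred; _≐_)

private
  variable
    n : ℕ

-- The vertex set is a subset of an ambient Fin n, so that
-- a structure and its induced substructures share one type, and
-- V(T) = V(H) and T - x = T′ are meaningful equations.

-- As structures are finite, the edge set is a decidable set of subsets.
record Hypergraph (n : ℕ) : Set₁ where
  field
    V       : Subset n
    E       : Pred (Subset n) 0ℓ
    E?      : U.Decidable E
    edge⊆V  : ∀ {e} → E e → e ⊆ V
    uniform : ∀ {e} → E e → ∣ e ∣ ≡ 3

record Tournament (n : ℕ) : Set₁ where
  field
    V          : Subset n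
    A          : Rel (Fin n) 0ℓ
    arc⊆V      : ∀ {v w} → A v w → v ∈ V × w ∈ V
    irrefl     : ∀ {v} → ¬ A v v
    exactlyOne : ∀ {v w} → v ∈ V → w ∈ V → v ≢ w →
                 (A v w × ¬ A w v) ⊎ (A w v × ¬ A v w)

record Graph (n : ℕ) : Set₁ where
  field
    V      : Subset n
    Adj    : Rel (Fin n) 0ℓ
    adj⊆V  : ∀ {v w} → Adj v w → v ∈ V × w ∈ V
    irrefl : ∀ {v} → ¬ Adj v v
    symm   : ∀ {v w} → Adj v w → Adj w v

open Hypergraph
open Tournament
open Graph

infix 4 _≈ᴴ_ _≈ᵀ_

_≈ᴴ_ : Hypergraph n → Hypergraph n → Set
H ≈ᴴ K = H .V ≡ K .V × H .E ≐ K .E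

_≈ᵀ_ : Tournament n → Tournament n → Set
S ≈ᵀ T = S .V ≡ T .V × S .A ⇔ᴿ T .A

inducedᴴ : (H : Hypergraph n) (W : Subset n) → W ⊆ H .V → Hypergraph n
inducedᴴ H W W⊆V = record
  { V       = W
  ; E       = λ e → H .E e × e ⊆ W
  ; E?      = λ e → H .E? e ×-dec e ⊆? W
  ; edge⊆V  = proj₂
  ; uniform = H .uniform ∘ proj₁
  }

inducedᵀ : (T : Tournament n) (W : Subset n) → W ⊆ T .V → Tournament n
inducedᵀ T W W⊆V = record
  { V          = W
  ; A          = λ v w → T .A v w × v ∈ W × w ∈ W
  ; arc⊆V      = proj₂
  ; irrefl     = T .irrefl ∘ proj₁
  ; exactlyOne = one
  }
  where
  one : ∀ {v w} → v ∈ W → w ∈ W → v ≢ w → _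
  one v∈W w∈W v≢w with T .exactlyOne (W⊆V v∈W) (W⊆V w∈W) v≢w
  ... | inj₁ (vw , ¬wv) = inj₁ ((vw , v∈W , w∈W) , ¬wv ∘ proj₁)
  ... | inj₂ (wv , ¬vw) = inj₂ ((wv , w∈W , v∈W) , ¬vw ∘ proj₁)

inducedᴳ : (G : Graph n) (W : Subset n) → W ⊆ G .V → Graph n
inducedᴳ G W W⊆V = record
  { V      = W
  ; Adj    = λ v w → G .Adj v w × v ∈ W × w ∈ W
  ; adj⊆V  = proj₂
  ; irrefl = G .irrefl ∘ proj₁
  ; symm   = λ (vw , v∈W , w∈W) → G .symm vw , w∈W , v∈W
  }

infixl 6 _-ᴴ_ _-ᵀ_

_-ᴴ_ : Hypergraph n → Fin n → Hypergraph n
H -ᴴ v = inducedᴴ H (H .V - v) (p─q⊆p (H .V) ⁅ v ⁆)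

_-ᵀ_ : Tournament n → Fin n → Tournament n
T -ᵀ v = inducedᵀ T (T .V - v) (p─q⊆p (T .V) ⁅ v ⁆)

IsModule : Hypergraph n → Subset n → Set
IsModule H M = M ⊆ H .V ×
  (∀ e → H .E e → Nonempty (e ∩ M) → Nonempty (e ─ M) →
   ∃[ m ] m ∈ M × e ∩ M ≡ ⁅ m ⁆ × (∀ k → k ∈ M → H .E ((e - m) ∪ ⁅ k ⁆)))

Trivial : Hypergraph n → Subset n → Set
Trivial H M = M ≡ ⊥ ⊎ M ≡ H .V ⊎ (∃[ v ] v ∈ H .V × M ≡ ⁅ v ⁆)

Decomposable : Hypergraph n → Set
Decomposable H = ∃[ M ] IsModule H M × ¬ Trivial H M

Prime : Hypergraph n → Set
Prime H = 3 ≤ ∣ H .V ∣ × (∀ M → IsModule H M → Trivial H M)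

Critical : Hypergraph n → Set
Critical H = Prime H × (∀ v → v ∈ H .V → Decomposable (H -ᴴ v))

data _⟶_ : Rel (Fin 3) 0ℓ where
  0⟶1 : zero           ⟶ suc zero
  1⟶2 : suc zero       ⟶ suc (suc zero)
  2⟶0 : suc (suc zero) ⟶ zero

-- f is an isomorphism from ({0,1,2}, {01,12,20}) onto T.
IsCycleIso : (T : Tournament n) → (Fin 3 → Fin n) → Set
IsCycleIso T f =
    Injective _≡_ _≡_ f
  × (∀ v → v ∈ T .V ⇔ (∃[ i ] f i ≡ v))
  × (∀ i j → i ⟶ j ⇔ T .A (f i) (f j))

Is3Cycle : Tournament n → Set
Is3Cycle T = ∃ (IsCycleIso T)

private
  ⇔-dec : {P Q : Set} → Dec P → Dec Q → Dec (P ⇔ Q)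
  ⇔-dec P? Q? = map′ (λ (f , g) → mk⇔ f g)
                     (λ p⇔q → Equivalence.to p⇔q , Equivalence.from p⇔q)
                     ((P? →-dec Q?) ×-dec (Q? →-dec P?))

  _⟶?_ : ∀ i j → Dec (i ⟶ j)
  zero           ⟶? zero           = no λ ()
  zero           ⟶? suc zero       = yes 0⟶1
  zero           ⟶? suc (suc zero) = no λ ()
  suc zero       ⟶? zero           = no λ ()
  suc zero       ⟶? suc zero       = no λ ()
  suc zero       ⟶? suc (suc zero) = yes 1⟶2
  suc (suc zero) ⟶? zero           = yes 2⟶0
  suc (suc zero) ⟶? suc zero       = no λ ()
  suc (suc zero) ⟶? suc (suc zero) = no λ ()

arc? : (T : Tournament n) → ∀ v w → Dec (T .A v w)
arc? T v w with v ≟ w | v ∈? T .V | w ∈? T .V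
... | yes refl | _       | _       = no (T .irrefl)
... | no _     | no v∉V  | _       = no (v∉V ∘ proj₁ ∘ T .arc⊆V)
... | no _     | yes _   | no w∉V  = no (w∉V ∘ proj₂ ∘ T .arc⊆V)
... | no v≢w   | yes v∈V | yes w∈V with T .exactlyOne v∈V w∈V v≢w
...   | inj₁ (vw , _)  = yes vw
...   | inj₂ (_ , ¬vw) = no ¬vw

is3Cycle? : (T : Tournament n) → Dec (Is3Cycle T)
is3Cycle? {n} T =
  map′ (λ (a , b , c , p) → triple a b c , p)
       (λ (f , p) → f zero , f (suc zero) , f (suc (suc zero)) , resp (agree f) p)
       (any? λ a → any? λ b → any? λ c → iso? (triple a b c))
  where
  triple : Fin n → Fin n → Fin n → Fin 3 → Fin n
  triple a b c = a ∷ b ∷ c ∷ []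

  agree : ∀ f i → f i ≡ triple (f zero) (f (suc zero)) (f (suc (suc zero))) i
  agree f zero             = refl
  agree f (suc zero)       = refl
  agree f (suc (suc zero)) = refl

  resp : ∀ {f g} → (∀ i → f i ≡ g i) → IsCycleIso T f → IsCycleIso T g
  resp f≗g (inj , onto , arcs) =
      (λ {i} {j} eq → inj (trans (f≗g i) (trans eq (sym (f≗g j)))))
    , (λ v → mk⇔ (map₂ (λ {i} → trans (sym (f≗g i))) ∘ Equivalence.to (onto v))
                 (Equivalence.from (onto v) ∘ map₂ (λ {i} → trans (f≗g i))))
    , (λ i j → mk⇔ (subst₂ (T .A) (f≗g i) (f≗g j) ∘ Equivalence.to (arcs i j))
                   (Equivalence.from (arcs i j)
                     ∘ subst₂ (T .A) (sym (f≗g i)) (sym (f≗g j))))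

  iso? : ∀ f → Dec (IsCycleIso T f)
  iso? f =
    map′ (λ inj {i} {j} → inj i j) (λ inj i j → inj)
         (all? λ i → all? λ j → (f i ≟ f j) →-dec (i ≟ j))
    ×-dec (all? λ v → ⇔-dec (v ∈? T .V) (any? λ i → f i ≟ v))
    ×-dec (all? λ i → all? λ j → ⇔-dec (i ⟶? j) (arc? T (f i) (f j)))

C₃ : Tournament n → Hypergraph n
C₃ T = record
  { V       = T .V
  ; E       = C₃-E
  ; E?      = C₃-E?
  ; edge⊆V  = λ (_ , X⊆V , _) → X⊆V
  ; uniform = proj₁
  }
  where
  C₃-E : Pred (Subset _) 0ℓ
  C₃-E X = ∣ X ∣ ≡ 3 × Σ[ X⊆V ∈ X ⊆ T .V ] Is3Cycle (inducedᵀ T X X⊆V)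

  C₃-E? : U.Decidable C₃-E
  C₃-E? X with ∣ X ∣ ℕ.≟ 3 | X ⊆? T .V
  ... | no ≢3  | _       = no (≢3 ∘ proj₁)
  ... | yes _  | no X⊈V  = no λ (_ , X⊆V , _) → X⊈V X⊆V
  ... | yes ≡3 | yes X⊆V =
    map′ (λ c → ≡3 , X⊆V , c) (proj₂ ∘ proj₂) (is3Cycle? (inducedᵀ T X X⊆V))

_Realizes_ : Tournament n → Hypergraph n → Set
T Realizes H = T .V ≡ H .V × H ≈ᴴ C₃ T

Realizable : Hypergraph n → Set₁
Realizable H = ∃[ T ] T Realizes H

Isolated : Graph n → Pred (Fin n) 0ℓ
Isolated G v = v ∈ G .V × (∀ w → ¬ G .Adj v w)

Connected : Graph n → Set
Connected G = Nonempty (G .V) ×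
  (∀ v w → v ∈ G .V → w ∈ G .V → Star (G .Adj) v w)

-- Components are induced, so they are given by their vertex sets.
IsComponent : (G : Graph n) (C : Subset n) → C ⊆ G .V → Set
IsComponent G C C⊆V = Connected (inducedᴳ G C C⊆V) ×
  (∀ D (D⊆V : D ⊆ G .V) → Connected (inducedᴳ G D D⊆V) → C ⊆ D → D ≡ C)

IsBipartition : Pred (Fin n) 0ℓ → Subset n → Subset n → Set
IsBipartition S P Q =
  Nonempty P × Nonempty Q × Empty (P ∩ Q) × (_∈ (P ∪ Q)) ≐ S

IsBipartiteWith : Graph n → Subset n → Subset n → Set
IsBipartiteWith G P Q = IsBipartition (_∈ G .V) P Q
  × (∀ v w → v ∈ P → w ∈ P → ¬ G .Adj v w)
  × (∀ v w → v ∈ Q → w ∈ Q → ¬ G .Adj v w)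

link : Hypergraph n → Fin n → Graph n
link H x = record
  { V      = H .V - x
  ; Adj    = λ v w → (v ∈ H .V - x × w ∈ H .V - x) × v ≢ w
                   × H .E (⁅ x ⁆ ∪ (⁅ v ⁆ ∪ ⁅ w ⁆))
  ; adj⊆V  = proj₁
  ; irrefl = λ (_ , v≢v , _) → v≢v refl
  ; symm   = λ {v} {w} ((v∈ , w∈) , v≢w , e) →
               (w∈ , v∈) , v≢w ∘ sym
             , subst (λ f → H .E (⁅ x ⁆ ∪ f)) (∪-comm ⁅ v ⁆ ⁅ w ⁆) e
  }
  where open import Data.Fin.Subset.Properties using (∪-comm)

module Conditions (H : Hypergraph n) (x : Fin n) (Tₓ : Tournament n) where

  Gₓ : Graph n
  Gₓ = link H x

  Iₓ : Pred (Fin n) 0ℓ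
  Iₓ = Isolated Gₓ

  Y⁻ : Subset n → Pred (Fin n) 0ℓ
  Y⁻ X⁻ v = Iₓ v ×
    (∃[ k ] Σ[ s ∈ (Fin (suc k) → Fin n) ]
       s zero ∈ X⁻ × s (fromℕ k) ≡ v
     × (∀ (i : Fin k) → Iₓ (s (suc i)))
     × (∀ (i : Fin k) → Tₓ .A (s (inject₁ i)) (s (suc i))))

  Y⁺ : Subset n → Pred (Fin n) 0ℓ
  Y⁺ X⁺ v = Iₓ v ×
    (∃[ k ] Σ[ s ∈ (Fin (suc k) → Fin n) ]
       s zero ∈ X⁺ × s (fromℕ k) ≡ v
     × (∀ (i : Fin k) → Iₓ (s (suc i)))
     × (∀ (i : Fin k) → Tₓ .A (s (suc i)) (s (inject₁ i))))

  M1 : Subset n → Subset n → Set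
  M1 X⁻ X⁺ =
      IsBipartition (λ v → v ∈ H .V - x × ¬ Iₓ v) X⁻ X⁺
    × (∀ C (C⊆V : C ⊆ Gₓ .V) → IsComponent Gₓ C C⊆V → 2 ≤ ∣ C ∣ →
       IsBipartiteWith (inducedᴳ Gₓ C C⊆V) (X⁻ ∩ C) (X⁺ ∩ C))
    × (∀ v⁻ v⁺ → v⁻ ∈ X⁻ → v⁺ ∈ X⁺ → Gₓ .Adj v⁻ v⁺ ⇔ Tₓ .A v⁻ v⁺)

  -- Each arc condition is quantified only over the sets it mentions, so
  -- it is not made vacuous by another of the four sets being empty.
  M2 : Subset n → Subset n → Set
  M2 X⁻ X⁺ =
      U.Empty (Y⁻ X⁻ U.∩ Y⁺ X⁺)
    × (Y⁻ X⁻ U.∪ Y⁺ X⁺) ≐ Iₓ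
    × (∀ {y⁺ x⁻} → Y⁺ X⁺ y⁺ → x⁻ ∈ X⁻ → Tₓ .A y⁺ x⁻)
    × (∀ {x⁺ y⁻} → x⁺ ∈ X⁺ → Y⁻ X⁻ y⁻ → Tₓ .A x⁺ y⁻)
    × (∀ {y⁺ y⁻} → Y⁺ X⁺ y⁺ → Y⁻ X⁻ y⁻ → Tₓ .A y⁺ y⁻)

  ArcsAt : Subset n → Subset n → Tournament n → Set
  ArcsAt X⁻ X⁺ T =
      (∀ {x⁻} → x⁻ ∈ X⁻ → T .A x x⁻)
    × (∀ {x⁺} → x⁺ ∈ X⁺ → T .A x⁺ x)
    × (∀ {y⁻} → Y⁻ X⁻ y⁻ → T .A x y⁻)
    × (∀ {y⁺} → Y⁺ X⁺ y⁺ → T .A y⁺ x)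

module Submission where

-- The heart of the matter is rigidity: two tournaments T and S whose common
-- C₃-structure is prime are equal or dual.  Call a pair of vertices black if
-- T and S disagree on it.  A 3-cycle is monochromatic, and if a → b → c in T
-- with ab and bc of one colour, then ac has that colour too.  Grow a strongly
-- connected set X without black pairs from a 3-cycle.  A vertex y ∉ X that
-- does not dominate X and is not dominated by X either has no black neighbour
-- in X, and X ∪ {y} continues the growth; or its black neighbours form a
-- proper module of T[X] whose twin over the rest of X is y.  In the latter
-- case, a maximal proper module B of T[X] together with all the vertices y
-- whose black neighbours lie in B is a module of T, contrary to primality.
-- Hence X is a module of T, so X = V(T).
--
-- By rigidity, a realization of H, or its dual, restricts to Tₓ.  If T does,
-- then X⁻ and X⁺ are the non-isolated out- and in-neighbours of x, and an
-- isolated v with x → v lies in Y⁻, because x and the isolated out-neighbours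
-- outside Y⁻ form a module of T.  Conversely (M1) and (M2) say that adding
-- the arcs x → X⁻ ∪ Y⁻ and X⁺ ∪ Y⁺ → x to Tₓ creates exactly the 3-cycles
-- {x, v, w} with vw an edge of the graph Gₓ.

open import Defs
open import Data.Empty using (⊥-elim)
open import Data.Fin using (Fin; zero; suc; fromℕ; inject₁)
open import Data.Fin.Properties using (any?; all?; _≟_)
open import Data.Fin.Subset
  using (Subset; ⁅_⁆; _∈_; _∉_; _⊆_; _∪_; _⊃_; _∩_; _─_; _-_; ∣_∣; outside; inside; Nonempty)
open import Data.Fin.Subset.Induction using (⊃-wellFounded; Acc; acc)
open import Data.Fin.Subset.Properties
open import Data.Nat using (ℕ; suc; _≤_; _<_; s≤s)
open import Data.Nat.Properties using (≤-trans; ≤-reflexive; suc-injective)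
open import Data.Product using (∃₂; ∃!; Σ-syntax; ∃-syntax; _×_; _,_; proj₁; proj₂; swap)
open import Data.Sum as Sum using (_⊎_; inj₁; inj₂; [_,_]′)
open import Data.Vec using (tabulate; _∷_; here; there)
open import Data.Vec.Functional using () renaming (_∷_ to _∷ᶠ_; [] to []ᶠ)
open import Data.Vec.Properties using (lookup⇒[]=; []=⇒lookup; lookup∘tabulate)
open import Function using (_∘_; flip; mk⇔; Equivalence; _⇔_)
open import Level using (0ℓ)
open import Relation.Binary using (Rel; Decidable)
open import Relation.Binary.Construct.Closure.ReflexiveTransitive
  using (Star; ε; _◅_; _◅◅_; reverse)
open import Relation.Binary.PropositionalEquality
  using (_≡_; _≢_; refl; sym; trans; subst; cong)
open import Relation.Nullary using (¬_; yes; no; does; contradiction)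
open import Relation.Nullary.Decidable
  using (¬?; _×-dec_; _⊎-dec_; decidable-stable; dec-true)
import Relation.Unary as U
open U using (Pred)

open Tournament
open Hypergraph

private
  variable
    n : ℕ

-- Subsets cut out by decidable predicates

module _ {P : Pred (Fin n) 0ℓ} (P? : U.Decidable P) where

  comprehension : Subset n
  comprehension = tabulate (does ∘ P?)

  ∈-comprehension⁺ : ∀ {v} → P v → v ∈ comprehension
  ∈-comprehension⁺ {v} pv = lookup⇒[]= v comprehension
    (trans (lookup∘tabulate (does ∘ P?) v) (dec-true (P? v) pv))

  ∈-comprehension⁻ : ∀ {v} → v ∈ comprehension → P v
  ∈-comprehension⁻ {v} v∈
    with P? v | trans (sym (lookup∘tabulate (does ∘ P?) v)) ([]=⇒lookup v∈)
  ... | yes pv | _ = pv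
  ... | no _   | ()

∉∪⁻ : ∀ {v} (p q : Subset n) → v ∉ p ∪ q → v ∉ p × v ∉ q
∉∪⁻ p q v∉ = v∉ ∘ p⊆p∪q q , v∉ ∘ q⊆p∪q p q

-- Tournaments, their modules, and colourings of their pairs

dual : Tournament n → Tournament n
dual T = record
  { V          = T .V
  ; A          = flip (T .A)
  ; arc⊆V      = swap ∘ T .arc⊆V
  ; irrefl     = T .irrefl
  ; exactlyOne = λ v∈ w∈ v≢w → [ inj₂ , inj₁ ]′ (T .exactlyOne v∈ w∈ v≢w)
  }

arc-total : (T : Tournament n) → ∀ {u v} → u ∈ T .V → v ∈ T .V → u ≢ v →
            T .A u v ⊎ T .A v u
arc-total T u∈ v∈ u≢v with T .exactlyOne u∈ v∈ u≢v
... | inj₁ (uv , _) = inj₁ uv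
... | inj₂ (vu , _) = inj₂ vu

arc-distinct : (T : Tournament n) → ∀ {u v} → T .A u v → u ≢ v
arc-distinct T uv refl = T .irrefl uv

arc-asym : (T : Tournament n) → ∀ {u v} → T .A u v → ¬ T .A v u
arc-asym T uv vu
  with T .exactlyOne (proj₁ (T .arc⊆V uv)) (proj₂ (T .arc⊆V uv)) (arc-distinct T uv)
... | inj₁ (_ , ¬vu) = ¬vu vu
... | inj₂ (_ , ¬uv) = ¬uv uv

-- Taken relative to `W`, so that modules of `T[X]` need no new tournament. Only arcs into `M` are
-- mentioned; totality carries the condition over to the arcs out of `M`.
IsTModule : Tournament n → Subset n → Subset n → Set
IsTModule T W M = M ⊆ W × (∀ {v m k} → v ∈ W → v ∉ M → m ∈ M → k ∈ M →
                           T .A v m → T .A v k)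

IsTModule-in : (T : Tournament n) → ∀ {W M} → W ⊆ T .V → IsTModule T W M →
               ∀ {v m k} → v ∈ W → v ∉ M → m ∈ M → k ∈ M → T .A m v → T .A k v
IsTModule-in T W⊆V (M⊆W , out) v∈W v∉M m∈M k∈M mv
  with arc-total T (W⊆V (M⊆W k∈M)) (W⊆V v∈W) (λ { refl → v∉M k∈M })
... | inj₁ kv = kv
... | inj₂ vk = ⊥-elim (arc-asym T mv (out v∈W v∉M k∈M m∈M vk))

IsTModule-dual : (T : Tournament n) → ∀ {W M} → W ⊆ T .V →
                 IsTModule T W M → IsTModule (dual T) W M
IsTModule-dual T W⊆V mod = proj₁ mod , IsTModule-in T W⊆V mod

-- The representatives `m` and `k` carry what an outside vertex sees from one module to the other.
-- If the modules share a vertex, taking it for both makes the bridge trivial.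
IsTModule-∪ : (T : Tournament n) → ∀ {W M N m k} → IsTModule T W M → IsTModule T W N →
              m ∈ M → k ∈ N →
              (∀ {w} → w ∈ W → w ∉ M → w ∉ N →
                (T .A w m → T .A w k) × (T .A w k → T .A w m)) →
              IsTModule T W (M ∪ N)
IsTModule-∪ T {W} {M} {N} {m} {k} (M⊆W , outM) (N⊆W , outN) m∈ k∈ bridge =
    [ M⊆W , N⊆W ]′ ∘ x∈p∪q⁻ M N , out
  where
  out : ∀ {v a b} → v ∈ W → v ∉ M ∪ N → a ∈ M ∪ N → b ∈ M ∪ N → T .A v a → T .A v b
  out v∈W v∉ a∈ b∈ va with ∉∪⁻ M N v∉
  ... | v∉M , v∉N with x∈p∪q⁻ M N a∈ | x∈p∪q⁻ M N b∈
  ... | inj₁ a∈M | inj₁ b∈M = outM v∈W v∉M a∈M b∈M va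
  ... | inj₁ a∈M | inj₂ b∈N =
    outN v∈W v∉N k∈ b∈N (proj₁ (bridge v∈W v∉M v∉N) (outM v∈W v∉M a∈M m∈ va))
  ... | inj₂ a∈N | inj₁ b∈M =
    outM v∈W v∉M m∈ b∈M (proj₂ (bridge v∈W v∉M v∉N) (outN v∈W v∉N a∈N k∈ va))
  ... | inj₂ a∈N | inj₂ b∈N = outN v∈W v∉N a∈N b∈N va

-- Strong connectivity: absence of a one-way cut.
Strong : Tournament n → Subset n → Set₁
Strong {n} T X = ∀ (P : Pred (Fin n) 0ℓ) → U.Decidable P →
  ∀ {a b} → a ∈ X → P a → b ∈ X → ¬ P b →
  ¬ (∀ {p q} → p ∈ X → q ∈ X → P p → ¬ P q → T .A p q)

-- A cut in the reversed tournament is a cut of `T` with its two sides exchanged; decidability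
-- removes the double negation.
Strong-dual : (T : Tournament n) → ∀ {X} → Strong T X → Strong (dual T) X
Strong-dual T strong P P? a∈ pa b∈ ¬pb cut =
  strong (¬_ ∘ P) (¬? ∘ P?) b∈ ¬pb a∈ (λ ¬pa → ¬pa pa)
    (λ p∈ q∈ ¬pp ¬¬pq → cut q∈ p∈ (decidable-stable (P? _) ¬¬pq) ¬pp)

TPrime : Tournament n → Set
TPrime T = ∀ M → IsTModule T (T .V) M → ∀ {a b} → a ∈ M → b ∈ M → a ≢ b → T .V ⊆ M

-- The pairs on which two tournaments with the same 3-cycles disagree form
-- such a D, and the defining conditions are symmetric in D and its complement.
record Colouring (T : Tournament n) : Set₁ where
  field
    D    : Rel (Fin n) 0ℓ
    D?   : Decidable D
    symm : ∀ {a b} → D a b → D b a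
    cyc  : ∀ {a b c} → T .A a b → T .A b c → T .A c a → D a b → D b c
    tr₀  : ∀ {a b c} → T .A a b → T .A b c → ¬ D a b → ¬ D b c → ¬ D a c
    tr₁  : ∀ {a b c} → T .A a b → T .A b c → D a b → D b c → D a c

dualColouring : {T : Tournament n} → Colouring T → Colouring (dual T)
dualColouring K = record
  { D    = D
  ; D?   = D?
  ; symm = symm
  -- The cycle is followed in the direction of `T`, where two uses of `cyc` lead from `ba` by way of
  -- `ac` to `cb`.
  ; cyc  = λ ba cb ac d → symm (cyc ac cb ba (cyc ba ac cb (symm d)))
  ; tr₀  = λ ba cb ¬ab ¬bc ac → tr₀ cb ba (¬bc ∘ symm) (¬ab ∘ symm) (symm ac)
  ; tr₁  = λ ba cb ab bc → symm (tr₁ cb ba (symm bc) (symm ab))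
  }
  where open Colouring K

complement : {T : Tournament n} → Colouring T → Colouring T
complement K = record
  { D    = λ u v → ¬ D u v
  ; D?   = λ u v → ¬? (D? u v)
  ; symm = _∘ symm
  -- Contrapositively, two further steps round the cycle lead from `bc` back to `ab`.
  ; cyc  = λ ab bc ca ¬d d → ¬d (cyc ca ab bc (cyc bc ca ab d))
  ; tr₀  = λ ab bc ¬¬ab ¬¬bc ¬ac →
             ¬ac (tr₁ ab bc (decidable-stable (D? _ _) ¬¬ab) (decidable-stable (D? _ _) ¬¬bc))
  ; tr₁  = tr₀
  }
  where open Colouring K

-- One outer vertex against a strongly connected set without black pairs

module Growth (T : Tournament n) (K : Colouring T) (X : Subset n) (X⊆V : X ⊆ T .V)
  (strong : Strong T X) (mono : ∀ {u v} → u ∈ X → v ∈ X → u ≢ v → ¬ Colouring.D K u v) where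

  open Colouring K

  Outer : Pred (Fin n) 0ℓ
  Outer y = y ∈ T .V × y ∉ X

  -- The outer vertices of this kind are those that keep `X` from being a module of `T`.
  Split : Pred (Fin n) 0ℓ
  Split y = (∃[ a ] a ∈ X × T .A a y) × (∃[ b ] b ∈ X × T .A y b)

  D∩X : Fin n → Subset n
  D∩X y = comprehension (λ u → (u ∈? X) ×-dec D? y u)

  ∈D∩X : ∀ {y u} → u ∈ X → D y u → u ∈ D∩X y
  ∈D∩X {y} u∈ d = ∈-comprehension⁺ (λ u → (u ∈? X) ×-dec D? y u) (u∈ , d)

  D∩X∈ : ∀ {y u} → u ∈ D∩X y → u ∈ X × D y u
  D∩X∈ {y} = ∈-comprehension⁻ (λ u → (u ∈? X) ×-dec D? y u)

  compare : ∀ {y w} → Outer y → w ∈ X → T .A y w ⊎ T .A w y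
  compare (y∈ , y∉) w∈ = arc-total T y∈ (X⊆V w∈) (λ { refl → y∉ w∈ })

  -- A black neighbour `u` of `y` relates to any other `w` in `X` just as `y` does: a directed path
  -- between `u` and `y` through `w` would consist of two non-black pairs, and `tr₀` would make `yu`
  -- non-black.
  module Twin {y u w} (y-out : Outer y) (u∈ : u ∈ X) (w∈ : w ∈ X) (yu : D y u) (¬yw : ¬ D y w) where

    compare′ : T .A u w ⊎ T .A w u
    compare′ = arc-total T (X⊆V u∈) (X⊆V w∈) (λ { refl → ¬yw yu })

    in⁺ : T .A w y → T .A w u
    in⁺ wy with compare′
    ... | inj₁ uw = ⊥-elim (tr₀ uw wy (mono u∈ w∈ (arc-distinct T uw)) (¬yw ∘ symm) (symm yu))
    ... | inj₂ wu = wu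

    out⁺ : T .A y w → T .A u w
    out⁺ yw with compare′
    ... | inj₁ uw = uw
    ... | inj₂ wu = ⊥-elim (tr₀ yw wu ¬yw (mono w∈ u∈ (arc-distinct T wu)) yu)

    in⁻ : T .A w u → T .A w y
    in⁻ wu with compare y-out w∈
    ... | inj₁ yw = ⊥-elim (arc-asym T wu (out⁺ yw))
    ... | inj₂ wy = wy

    out⁻ : T .A u w → T .A y w
    out⁻ uw with compare y-out w∈
    ... | inj₁ yw = yw
    ... | inj₂ wy = ⊥-elim (arc-asym T uw (in⁺ wy))

  -- If `u → y → w` with both pairs black, `tr₁` would make `uw` a black pair inside `X`.
  D∩X-out : ∀ {y u w} → Outer y → u ∈ X → w ∈ X → D y u → D y w → T .A u y → T .A w y
  D∩X-out y-out u∈ w∈ yu yw u→y with compare y-out w∈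
  ... | inj₁ y→w = ⊥-elim (mono u∈ w∈ (λ { refl → arc-asym T u→y y→w })
                            (tr₁ u→y y→w (symm yu) yw))
  ... | inj₂ w→y = w→y

  -- By `Twin`, a vertex of `X` outside `D∩X y` sees every member of it as it sees `y`.
  D∩X-module : ∀ {y} → Outer y → IsTModule T X (D∩X y)
  D∩X-module {y} y-out = proj₁ ∘ D∩X∈ , out
    where
    out : ∀ {v m k} → v ∈ X → v ∉ D∩X y → m ∈ D∩X y → k ∈ D∩X y → T .A v m → T .A v k
    out v∈ v∉ m∈ k∈ vm with D∩X∈ m∈ | D∩X∈ k∈
    ... | m∈X , ym | k∈X , yk =
      Twin.in⁺ y-out k∈X v∈ yk ¬yv (Twin.in⁻ y-out m∈X v∈ ym ¬yv vm)
      where ¬yv = v∉ ∘ ∈D∩X v∈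

  D∩X-proper : ∀ {y} → Outer y → Split y → ∃[ q ] q ∈ X × ¬ D y q
  D∩X-proper {y} y-out ((a , a∈ , ay) , (b , b∈ , yb)) with D? y a | D? y b
  ... | no ¬ya | _      = a , a∈ , ¬ya
  ... | _      | no ¬yb = b , b∈ , ¬yb
  ... | yes ya | yes yb′ = ⊥-elim (arc-asym T yb (D∩X-out y-out a∈ b∈ ya yb′ ay))

  -- By `Twin`, the black neighbours of `y` inherit its arcs to the other vertices of `X`. This is a
  -- cut of `X` unless one of the two kinds is missing.
  dominating-mono : ∀ {y u w} → Outer y → (∀ {q} → q ∈ X → T .A y q) →
                    u ∈ X → w ∈ X → D y u → D y w
  dominating-mono {y} {u} {w} y-out y→X u∈ w∈ yu with D? y w
  ... | yes yw = yw
  ... | no ¬yw = ⊥-elim (strong (D y) (D? y) u∈ yu w∈ ¬yw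
                   (λ p∈ q∈ yp ¬yq → Twin.out⁺ y-out p∈ q∈ yp ¬yq (y→X q∈)))

  -- Under a cover, every vertex of `X` outside `B` lies in `M` and so relates to `q` as `a` does,
  -- while all of `B` relates to such a vertex as `q` does. The one arc between `a` and `q` thus
  -- spreads to all pairs across `B`, which is a cut.
  modules-do-not-cover : ∀ {B M a q} → IsTModule T X B → IsTModule T X M →
    a ∈ X → a ∉ B → q ∈ X → q ∉ M → ¬ (∀ {v} → v ∈ X → v ∉ B → v ∈ M)
  modules-do-not-cover {B} {M} {a} {q} modB modM a∈ a∉B q∈ q∉M covers
    with arc-total T (X⊆V a∈) (X⊆V q∈) (λ { refl → q∉M (covers a∈ a∉B) })
  ... | inj₁ aq = strong (_∉ B) (λ v → ¬? (v ∈? B)) a∈ a∉B q∈ (λ q∉B → q∉B q∈B)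
    (λ p∈ r∈ p∉B ¬r∉B → proj₂ modB p∈ p∉B q∈B (decidable-stable (_ ∈? B) ¬r∉B)
       (IsTModule-in T X⊆V modM q∈ q∉M (covers a∈ a∉B) (covers p∈ p∉B) aq))
    where q∈B = decidable-stable (q ∈? B) (q∉M ∘ covers q∈)
  ... | inj₂ qa = strong (_∈ B) (_∈? B) q∈ q∈B a∈ a∉B
    (λ p∈ r∈ p∈B r∉B → IsTModule-in T X⊆V modB r∈ r∉B q∈B p∈B
       (proj₂ modM q∈ q∉M (covers a∈ a∉B) (covers r∈ r∉B) qa))
    where q∈B = decidable-stable (q ∈? B) (q∉M ∘ covers q∈)

  module Block {B : Subset n} {b₀ a₀ : Fin n} (modB : IsTModule T X B) (b₀∈ : b₀ ∈ B)
    (a₀∈ : a₀ ∈ X) (a₀∉ : a₀ ∉ B) where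

    -- y sees X ∖ B exactly as B does.
    Attached : Pred (Fin n) 0ℓ
    Attached y = Outer y × (∀ {u} → u ∈ X → D y u → u ∈ B) × (∃[ u ] u ∈ X × D y u)

    -- This and the next two lemmas treat the possible positions of a vertex `v` outside the block:
    -- in `X`, dominating `X`, or with a black neighbour in `X` outside `B`. Here an attached `y`
    -- sees `v` as its black neighbour in `B` does.
    clash-inner : ∀ {v y} → v ∈ X → v ∉ B → y ∈ B ⊎ Attached y → T .A v b₀ → ¬ T .A y v
    clash-inner v∈ v∉ (inj₁ y∈) vb yv = arc-asym T yv (proj₂ modB v∈ v∉ b₀∈ y∈ vb)
    clash-inner v∈ v∉ (inj₂ (y-out , D⊆B , u , u∈ , yu)) vb yv =
      arc-asym T yv (Twin.in⁻ y-out u∈ v∈ yu (v∉ ∘ D⊆B v∈)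
                       (proj₂ modB v∈ v∉ b₀∈ (D⊆B u∈ yu) vb))

    -- An arc `y → v` would make `B` dominate the rest of `X`. Otherwise some `q` outside `B` has
    -- `q → y`, and the 3-cycle `v q y` contains the non-black pair `yq`, so all of it is non-black.
    -- By `dominating-mono` then `vu` is non-black too, and `y → v → u` contradicts that `yu` is
    -- black.
    clash-dominating : ∀ {v y} → Outer v → (∀ {u} → u ∈ X → T .A v u) →
                       y ∈ B ⊎ Attached y → ¬ T .A y v
    clash-dominating v-out v→X (inj₁ y∈) yv = arc-asym T yv (v→X (proj₁ modB y∈))
    clash-dominating {v} {y} v-out v→X (inj₂ (y-out , D⊆B , u , u∈ , yu)) y→v =
      strong (_∈ B) (_∈? B) (proj₁ modB b₀∈) b₀∈ a₀∈ a₀∉ B→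
      where
      B→ : ∀ {p q} → p ∈ X → q ∈ X → p ∈ B → q ∉ B → T .A p q
      B→ {p} {q} p∈ q∈ p∈B q∉B
        with arc-total T (X⊆V p∈) (X⊆V q∈) (λ { refl → q∉B p∈B })
      ... | inj₁ pq = pq
      ... | inj₂ qp = ⊥-elim (tr₀ y→v (v→X u∈) ¬yv ¬vu yu)
        where
        ¬yq : ¬ D y q
        ¬yq = q∉B ∘ D⊆B q∈
        q→y : T .A q y
        q→y = Twin.in⁻ y-out u∈ q∈ yu ¬yq (proj₂ modB q∈ q∉B p∈B (D⊆B u∈ yu) qp)
        ¬vq : ¬ D v q
        ¬vq vq = ¬yq (symm (cyc (v→X q∈) q→y y→v vq))
        ¬yv : ¬ D y v
        ¬yv yv = ¬vq (cyc y→v (v→X q∈) q→y yv)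
        ¬vu : ¬ D v u
        ¬vu vu = ¬vq (dominating-mono v-out v→X u∈ q∈ vu)

    -- If `B` meets the black neighbours of `v`, the union of these two modules is a module. If not,
    -- `v` dominates `B`, and an attached `y` with `y → v` forces `yv` to be black. Then `y` and `v`
    -- agree on the rest of `X`, and their twins `m` and `u` bridge the two modules.
    clash-split : ∀ {v y u} → Outer v → u ∈ X → D v u → u ∉ B →
                  ¬ IsTModule T X (B ∪ D∩X v) →
                  y ∈ B ⊎ Attached y → T .A v b₀ → ¬ T .A y v
    clash-split {v} {y} {u} v-out u∈ vu u∉B ¬mod y-in vb yv
      with any? (λ c → (c ∈? B) ×-dec D? v c)
    ... | yes (c , c∈ , vc) =
      ¬mod (IsTModule-∪ T modB (D∩X-module v-out) c∈ (∈D∩X (proj₁ modB c∈) vc)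
              (λ _ _ _ → (λ wc → wc) , (λ wc → wc)))
    ... | no disjoint = go y-in
      where
      -- `u` is a twin of `v` outside `B`: the arc to `b₀` passes from `v` to `u`, spreads over the
      -- module `B`, and returns to `v`.
      v→B : ∀ {b} → b ∈ B → T .A v b
      v→B {b} b∈ = Twin.out⁻ v-out u∈ (proj₁ modB b∈) vu (λ d → disjoint (b , b∈ , d))
        (proj₂ modB u∈ u∉B b₀∈ b∈
          (Twin.out⁺ v-out u∈ (proj₁ modB b₀∈) vu (λ d → disjoint (b₀ , b₀∈ , d)) vb))

      go : y ∈ B ⊎ Attached y → _
      go (inj₁ y∈) = arc-asym T yv (v→B y∈)
      go (inj₂ (y-out , D⊆B , m , m∈ , ym)) =
        ¬mod (IsTModule-∪ T modB (D∩X-module v-out) m∈B (∈D∩X u∈ vu)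
                (λ w∈ w∉B w∉D → (λ wm → Twin.in⁺ v-out u∈ w∈ vu (w∉D ∘ ∈D∩X w∈)
                                   (y⇒v w∈ (w∉D ∘ ∈D∩X w∈)
                                     (Twin.in⁻ y-out m∈ w∈ ym (w∉B ∘ D⊆B w∈) wm)))
                              , (λ wu → Twin.in⁺ y-out m∈ w∈ ym (w∉B ∘ D⊆B w∈)
                                   (v⇒y w∈ w∉B (w∉D ∘ ∈D∩X w∈)
                                     (Twin.in⁻ v-out u∈ w∈ vu (w∉D ∘ ∈D∩X w∈) wu)))))
        where
        m∈B : m ∈ B
        m∈B = D⊆B m∈ ym
        yv-D : D y v
        yv-D = decidable-stable (D? y v)
          (λ ¬yv → tr₀ yv (v→B m∈B) ¬yv (λ d → disjoint (m , m∈B , d)) ym)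
        -- As `yv` is black, a 3-cycle `y v w` would make `vw` black, and a path `y → w → v` of
        -- non-black pairs would make `yv` non-black.
        y⇒v : ∀ {w} → w ∈ X → ¬ D v w → T .A w y → T .A w v
        y⇒v w∈ ¬vw wy with compare v-out w∈
        ... | inj₁ vw = ⊥-elim (¬vw (cyc yv vw wy yv-D))
        ... | inj₂ wv = wv
        v⇒y : ∀ {w} → w ∈ X → w ∉ B → ¬ D v w → T .A w v → T .A w y
        v⇒y w∈ w∉B ¬vw wv with compare y-out w∈
        ... | inj₁ yw = ⊥-elim (tr₀ yw wv (w∉B ∘ D⊆B w∈) (¬vw ∘ symm) yv-D)
        ... | inj₂ wy = wy

-- A set that cannot grow is the whole vertex set

module Saturated (T : Tournament n) (K : Colouring T) (X : Subset n) (X⊆V : X ⊆ T .V)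
  (strong : Strong T X) (mono : ∀ {u v} → u ∈ X → v ∈ X → u ≢ v → ¬ Colouring.D K u v)
  (prime : TPrime T)
  (saturated : ∀ {y} → Growth.Outer T K X X⊆V strong mono y →
    Growth.Split T K X X⊆V strong mono y → ¬ (∀ {u} → u ∈ X → ¬ Colouring.D K y u)) where

  open Colouring K
  open Growth T K X X⊆V strong mono
  -- With all arcs reversed, the same lemmas treat the outside vertices that receive an arc from
  -- `b₀`.
  module Op = Growth (dual T) (dualColouring K) X X⊆V (Strong-dual T strong) mono

  D-neighbour : ∀ {y} → Outer y → Split y → ∃[ u ] u ∈ X × D y u
  D-neighbour {y} y-out split with any? (λ u → (u ∈? X) ×-dec D? y u)
  ... | yes found = found
  ... | no none = ⊥-elim (saturated y-out split (λ {u} u∈ d → none (u , u∈ , d)))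

  -- Saturation gives each split outer vertex a black neighbour, so the vertices added to `B` here
  -- are `Attached` to it.
  Hull : Subset n → Pred (Fin n) 0ℓ
  Hull B v = v ∈ B ⊎ (Outer v × Split v × (∀ u → u ∈ X → D v u → u ∈ B))

  Outer? : U.Decidable Outer
  Outer? v = (v ∈? T .V) ×-dec ¬? (v ∈? X)

  Split? : U.Decidable Split
  Split? v = any? (λ a → (a ∈? X) ×-dec arc? T a v) ×-dec any? (λ b → (b ∈? X) ×-dec arc? T v b)

  ¬D⊆ : Subset n → Pred (Fin n) 0ℓ
  ¬D⊆ B v = ∃[ u ] u ∈ X × D v u × u ∉ B

  D⊆⊎¬D⊆ : ∀ B v → (∀ u → u ∈ X → D v u → u ∈ B) ⊎ ¬D⊆ B v
  D⊆⊎¬D⊆ B v with any? (λ u → (u ∈? X) ×-dec D? v u ×-dec ¬? (u ∈? B))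
  ... | yes found = inj₂ found
  ... | no none = inj₁ (λ u u∈ d →
    decidable-stable (u ∈? B) (λ u∉ → none (u , u∈ , d , u∉)))

  Hull? : ∀ B → U.Decidable (Hull B)
  Hull? B v with v ∈? B | Outer? v | Split? v | D⊆⊎¬D⊆ B v
  ... | yes v∈ | _     | _     | _                     = yes (inj₁ v∈)
  ... | no v∉  | no ¬o | _     | _                     = no [ v∉ , ¬o ∘ proj₁ ]′
  ... | no v∉  | yes _ | no ¬s | _                     = no [ v∉ , ¬s ∘ proj₁ ∘ proj₂ ]′
  ... | no v∉  | yes o | yes s | inj₁ D⊆B              = yes (inj₂ (o , s , D⊆B))
  ... | no v∉  | yes _ | yes _ | inj₂ (u , u∈ , d , u∉) =
    no [ v∉ , (λ (_ , _ , D⊆B) → u∉ (D⊆B u u∈ d)) ]′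

  -- If the hull of B is not a module of T, then some B ∪ D∩X v is a larger
  -- proper module of T[X]; so a largest block contradicts primality.
  no-block : ∀ {B} → Acc _⊃_ B → IsTModule T X B → ∀ {b₀ a₀ y₀} → b₀ ∈ B → a₀ ∈ X → a₀ ∉ B →
             Outer y₀ → Split y₀ → ¬ (∀ u → u ∈ X → D y₀ u → u ∈ B)
  no-block {B} (acc rec) modB {b₀} {a₀} {y₀} b₀∈ a₀∈ a₀∉ y₀-out y₀-split D⊆B =
    -- The hull holds two distinct vertices, `b₀` and `y₀`, so as a module it is all of `V`; but
    -- `a₀` is not in it.
    not-hull a₀∈ a₀∉ (hull⁻ (prime hull (hull⊆V , sees)
      (hull⁺ (inj₁ b₀∈)) (hull⁺ (inj₂ (y₀-out , y₀-split , D⊆B)))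
      (λ { refl → proj₂ y₀-out (proj₁ modB b₀∈) }) (X⊆V a₀∈)))
    where
    open Block modB b₀∈ a₀∈ a₀∉
    module OpB = Op.Block (IsTModule-dual T X⊆V modB) b₀∈ a₀∈ a₀∉

    hull : Subset n
    hull = comprehension (Hull? B)
    hull⁺ : ∀ {v} → Hull B v → v ∈ hull
    hull⁺ = ∈-comprehension⁺ (Hull? B)
    hull⁻ : ∀ {v} → v ∈ hull → Hull B v
    hull⁻ = ∈-comprehension⁻ (Hull? B)

    not-hull : ∀ {v} → v ∈ X → v ∉ B → ¬ Hull B v
    not-hull v∈ v∉ = [ v∉ , (λ (v-out , _) → proj₂ v-out v∈) ]′

    hull⊆V : hull ⊆ T .V
    hull⊆V = [ X⊆V ∘ proj₁ modB , proj₁ ∘ proj₁ ]′ ∘ hull⁻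

    -- The union would be a larger block still containing the black neighbours of `y₀`, to which the
    -- recursion applies, unless it fills `X`; but two proper modules do not cover `X`.
    no-enlargement : ∀ {v u} → Outer v → Split v → u ∈ X → D v u → u ∉ B →
                     ¬ IsTModule T X (B ∪ D∩X v)
    no-enlargement {v} {u} v-out v-split u∈ vu u∉ mod
      with any? (λ a → (a ∈? X) ×-dec ¬? (a ∈? B) ×-dec ¬? (D? v a))
    ... | yes (a , a∈ , a∉B , ¬va) =
      no-block (rec (p⊆p∪q (D∩X v) , u , q⊆p∪q B (D∩X v) (∈D∩X u∈ vu) , u∉)) mod
        (p⊆p∪q (D∩X v) b₀∈) a∈
        ([ a∉B , ¬va ∘ proj₂ ∘ D∩X∈ ]′ ∘ x∈p∪q⁻ B (D∩X v))
        y₀-out y₀-split (λ w w∈ d → p⊆p∪q (D∩X v) (D⊆B w w∈ d))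
    ... | no none =
      let q , q∈ , ¬vq = D∩X-proper v-out v-split in
      modules-do-not-cover modB (D∩X-module v-out) a₀∈ a₀∉ q∈ (¬vq ∘ proj₂ ∘ D∩X∈)
        (λ {w} w∈ w∉B → ∈D∩X w∈ (decidable-stable (D? v w) (λ ¬vw → none (w , w∈ , w∉B , ¬vw))))

    attached : ∀ {y} → Hull B y → y ∈ B ⊎ Attached y
    attached (inj₁ y∈) = inj₁ y∈
    attached (inj₂ (y-out , y-split , D⊆)) =
      inj₂ (y-out , (λ {u} → D⊆ u) , D-neighbour y-out y-split)

    clash : ∀ {v y} → v ∈ T .V → ¬ Hull B v → Hull B y → T .A v b₀ → ¬ T .A y v
    clash {v} v∈ ¬hv hy vb with v ∈? X
    ... | yes v∈X = clash-inner v∈X (¬hv ∘ inj₁) (attached hy) vb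
    ... | no v∉X with any? (λ a → (a ∈? X) ×-dec arc? T a v)
    ...   | no none = clash-dominating (v∈ , v∉X)
      (λ {u} u∈ → [ (λ vu → vu) , (λ uv → ⊥-elim (none (u , u∈ , uv))) ]′ (compare (v∈ , v∉X) u∈))
      (attached hy)
    -- With an arc from `X` and its arc to `b₀`, `v` is split; being outside the hull, it has a
    -- black neighbour outside `B`.
    ...   | yes into with D⊆⊎¬D⊆ B v
    ...     | inj₁ D⊆ = ⊥-elim (¬hv (inj₂ ((v∈ , v∉X) , (into , b₀ , proj₁ modB b₀∈ , vb) , D⊆)))
    ...     | inj₂ (u , u∈ , vu , u∉) =
      clash-split (v∈ , v∉X) u∈ vu u∉
        (no-enlargement (v∈ , v∉X) (into , b₀ , proj₁ modB b₀∈ , vb) u∈ vu u∉) (attached hy) vb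

    clashᵒᵖ : ∀ {v y} → v ∈ T .V → ¬ Hull B v → Hull B y → T .A b₀ v → ¬ T .A v y
    clashᵒᵖ {v} v∈ ¬hv hy bv with v ∈? X
    ... | yes v∈X = OpB.clash-inner v∈X (¬hv ∘ inj₁) (attached hy) bv
    ... | no v∉X with any? (λ a → (a ∈? X) ×-dec arc? T v a)
    ...   | no none = OpB.clash-dominating (v∈ , v∉X)
      (λ {u} u∈ → [ (λ vu → ⊥-elim (none (u , u∈ , vu))) , (λ uv → uv) ]′ (compare (v∈ , v∉X) u∈))
      (attached hy)
    ...   | yes out with D⊆⊎¬D⊆ B v
    ...     | inj₁ D⊆ = ⊥-elim (¬hv (inj₂ ((v∈ , v∉X) , ((b₀ , proj₁ modB b₀∈ , bv) , out) , D⊆)))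
    ...     | inj₂ (u , u∈ , vu , u∉) =
      OpB.clash-split (v∈ , v∉X) u∈ vu u∉
        (no-enlargement (v∈ , v∉X) ((b₀ , proj₁ modB b₀∈ , bv) , out) u∈ vu u∉
          ∘ IsTModule-dual (dual T) X⊆V)
        (attached hy) bv

    sees : ∀ {v m k} → v ∈ T .V → v ∉ hull → m ∈ hull → k ∈ hull → T .A v m → T .A v k
    sees {v} v∈ v∉ m∈ k∈ vm
      -- Should `k → v` hold, the arc between `v` and `b₀` decides whether `k → v` or `v → m` is the
      -- one that clashes.
      with arc-total T v∈ (hull⊆V k∈) (λ { refl → v∉ k∈ })
         | arc-total T v∈ (X⊆V (proj₁ modB b₀∈)) (λ { refl → v∉ (hull⁺ (inj₁ b₀∈)) })
    ... | inj₁ vk | _       = vk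
    ... | inj₂ kv | inj₁ vb = ⊥-elim (clash v∈ (v∉ ∘ hull⁺) (hull⁻ k∈) vb kv)
    ... | inj₂ _  | inj₂ bv = ⊥-elim (clashᵒᵖ v∈ (v∉ ∘ hull⁺) (hull⁻ m∈) bv vm)

  no-split : ∀ {y} → Outer y → ¬ Split y
  no-split {y} y-out split =
    let u , u∈ , yu  = D-neighbour y-out split
        q , q∈ , ¬yq = D∩X-proper y-out split
    -- The black neighbours of `y` form the first block.
    in no-block (⊃-wellFounded (D∩X y)) (D∩X-module y-out) (∈D∩X u∈ yu) q∈
         (¬yq ∘ proj₂ ∘ D∩X∈) y-out split (λ w w∈ d → ∈D∩X w∈ d)

  everything : ∀ {a b} → a ∈ X → b ∈ X → a ≢ b → T .V ⊆ X
  everything = prime X (X⊆V , out)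
    where
    out : ∀ {v m k} → v ∈ T .V → v ∉ X → m ∈ X → k ∈ X → T .A v m → T .A v k
    out {v} {m} {k} v∈ v∉ m∈ k∈ vm with compare (v∈ , v∉) k∈
    ... | inj₁ vk = vk
    ... | inj₂ kv = ⊥-elim (no-split (v∈ , v∉) ((k , k∈ , kv) , (m , m∈ , vm)))

-- The growth argument

module _ (T : Tournament n) (prime : TPrime T) where

  grow-mono : (K : Colouring T) → ∀ {X} → Acc _⊃_ X → X ⊆ T .V → Strong T X →
              (∀ {u v} → u ∈ X → v ∈ X → u ≢ v → ¬ Colouring.D K u v) →
              ∀ {a b} → a ∈ X → b ∈ X → a ≢ b →
              ∀ {u v} → u ∈ T .V → v ∈ T .V → u ≢ v → ¬ Colouring.D K u v
  grow-mono K {X} (acc rec) X⊆V strong mono {a} {b} a∈ b∈ a≢b u∈ v∈ u≢v uv =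
    mono (V⊆X u∈) (V⊆X v∈) u≢v uv
    where
    open Colouring K
    open Growth T K X X⊆V strong mono

    saturated : ∀ {y} → Outer y → Split y → ¬ (∀ {u} → u ∈ X → ¬ D y u)
    saturated {y} (y∈V , y∉) ((p , p∈ , py) , (q , q∈ , yq)) none =
      -- By recursion the enlarged set shows that `T` has no black pair at all, against `uv`.
      grow-mono K (rec (X⊆X⁺ , y , y∈X⁺ , y∉)) X⁺⊆V strong⁺ mono⁺
        (X⊆X⁺ a∈) (X⊆X⁺ b∈) a≢b u∈ v∈ u≢v uv
      where
      X⁺ = X ∪ ⁅ y ⁆
      X⊆X⁺ : X ⊆ X⁺
      X⊆X⁺ = p⊆p∪q ⁅ y ⁆
      y∈X⁺ : y ∈ X⁺
      y∈X⁺ = q⊆p∪q X ⁅ y ⁆ (x∈⁅x⁆ y)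
      X⁺∈ : ∀ {v} → v ∈ X⁺ → v ∈ X ⊎ v ≡ y
      X⁺∈ v∈ = [ inj₁ , inj₂ ∘ x∈⁅y⁆⇒x≡y y ]′ (x∈p∪q⁻ X ⁅ y ⁆ v∈)
      X⁺⊆V : X⁺ ⊆ T .V
      X⁺⊆V v∈ with X⁺∈ v∈
      ... | inj₁ v∈X = X⊆V v∈X
      ... | inj₂ refl = y∈V
      mono⁺ : ∀ {u v} → u ∈ X⁺ → v ∈ X⁺ → u ≢ v → ¬ D u v
      mono⁺ u∈ v∈ u≢v with X⁺∈ u∈ | X⁺∈ v∈
      ... | inj₁ u∈X  | inj₁ v∈X  = mono u∈X v∈X u≢v
      ... | inj₁ u∈X  | inj₂ refl = none u∈X ∘ symm
      ... | inj₂ refl | inj₁ v∈X  = none v∈X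
      ... | inj₂ refl | inj₂ refl = ⊥-elim (u≢v refl)
      -- A cut of `X⁺` either cuts `X` already or separates `y` from all of `X`, which the arcs
      -- `p → y → q` preclude.
      strong⁺ : Strong T X⁺
      strong⁺ P P? {c} {d} c∈ pc d∈ ¬pd cut with P? y
      ... | yes py′ with any? (λ r → (r ∈? X) ×-dec P? r)
      ...   | no empty = arc-asym T py (cut y∈X⁺ (X⊆X⁺ p∈) py′ (λ pp → empty (p , p∈ , pp)))
      ...   | yes (r , r∈ , pr) with X⁺∈ d∈
      ...     | inj₂ refl = ¬pd py′
      ...     | inj₁ d∈X = strong P P? r∈ pr d∈X ¬pd (λ p∈ q∈ → cut (X⊆X⁺ p∈) (X⊆X⁺ q∈))
      strong⁺ P P? {c} {d} c∈ pc d∈ ¬pd cut | no ¬py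
        with any? (λ r → (r ∈? X) ×-dec ¬? (P? r))
      ...   | no full = arc-asym T yq (cut (X⊆X⁺ q∈) y∈X⁺
                (decidable-stable (P? q) (λ ¬pq → full (q , q∈ , ¬pq))) ¬py)
      ...   | yes (r , r∈ , ¬pr) with X⁺∈ c∈
      ...     | inj₂ refl = ¬py pc
      ...     | inj₁ c∈X = strong P P? c∈X pc r∈ ¬pr (λ p∈ q∈ → cut (X⊆X⁺ p∈) (X⊆X⁺ q∈))

    V⊆X : T .V ⊆ X
    V⊆X = Saturated.everything T K X X⊆V strong mono prime saturated a∈ b∈ a≢b

-- Cardinalities and three-element subsets

x∈p─q⇒x∉q : ∀ {x : Fin n} (p q : Subset n) → x ∈ p ─ q → x ∉ q
x∈p─q⇒x∉q (_ ∷ p) (outside ∷ q) here ()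
x∈p─q⇒x∉q (_ ∷ p) (outside ∷ q) (there x∈) (there x∈q) = x∈p─q⇒x∉q p q x∈ x∈q
x∈p─q⇒x∉q (_ ∷ p) (inside  ∷ q) (there x∈) (there x∈q) = x∈p─q⇒x∉q p q x∈ x∈q

x∈p-y⇒x≢y : ∀ {x y : Fin n} (p : Subset n) → x ∈ p - y → x ≢ y
x∈p-y⇒x≢y p x∈ refl = x∈p─q⇒x∉q p _ x∈ (x∈⁅x⁆ _)

∣⁅x⁆∪p∣≡1+∣p∣ : ∀ {x : Fin n} (p : Subset n) → x ∉ p → ∣ ⁅ x ⁆ ∪ p ∣ ≡ suc ∣ p ∣
∣⁅x⁆∪p∣≡1+∣p∣ {x = zero}  (inside  ∷ p) x∉ = ⊥-elim (x∉ here)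
∣⁅x⁆∪p∣≡1+∣p∣ {x = zero}  (outside ∷ p) x∉ = cong (suc ∘ ∣_∣) (∪-identityˡ p)
∣⁅x⁆∪p∣≡1+∣p∣ {x = suc x} (inside  ∷ p) x∉ = cong suc (∣⁅x⁆∪p∣≡1+∣p∣ p (x∉ ∘ there))
∣⁅x⁆∪p∣≡1+∣p∣ {x = suc x} (outside ∷ p) x∉ = ∣⁅x⁆∪p∣≡1+∣p∣ p (x∉ ∘ there)

∣⁅x⁆∪⁅y⁆∣≡2 : ∀ {x y : Fin n} → x ≢ y → ∣ ⁅ x ⁆ ∪ ⁅ y ⁆ ∣ ≡ 2
∣⁅x⁆∪⁅y⁆∣≡2 {y = y} x≢y =
  trans (∣⁅x⁆∪p∣≡1+∣p∣ ⁅ y ⁆ (x≢y ∘ x∈⁅y⁆⇒x≡y y)) (cong suc (∣⁅x⁆∣≡1 y))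

triple : Fin n → Fin n → Fin n → Subset n
triple a b c = ⁅ a ⁆ ∪ (⁅ b ⁆ ∪ ⁅ c ⁆)

module _ {a b c : Fin n} where

  triple-1st : a ∈ triple a b c
  triple-1st = x∈p∪q⁺ (inj₁ (x∈⁅x⁆ a))

  triple-2nd : b ∈ triple a b c
  triple-2nd = x∈p∪q⁺ (inj₂ (x∈p∪q⁺ (inj₁ (x∈⁅x⁆ b))))

  triple-3rd : c ∈ triple a b c
  triple-3rd = x∈p∪q⁺ (inj₂ (x∈p∪q⁺ (inj₂ (x∈⁅x⁆ c))))

  ∈triple⁻ : ∀ {v} → v ∈ triple a b c → v ≡ a ⊎ v ≡ b ⊎ v ≡ c
  ∈triple⁻ v∈ with x∈p∪q⁻ ⁅ a ⁆ _ v∈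
  ... | inj₁ v∈a = inj₁ (x∈⁅y⁆⇒x≡y a v∈a)
  ... | inj₂ v∈bc with x∈p∪q⁻ ⁅ b ⁆ ⁅ c ⁆ v∈bc
  ...   | inj₁ v∈b = inj₂ (inj₁ (x∈⁅y⁆⇒x≡y b v∈b))
  ...   | inj₂ v∈c = inj₂ (inj₂ (x∈⁅y⁆⇒x≡y c v∈c))

  triple-⊆ : ∀ {p : Subset n} → a ∈ p → b ∈ p → c ∈ p → triple a b c ⊆ p
  triple-⊆ a∈ b∈ c∈ v∈ with ∈triple⁻ v∈
  ... | inj₁ refl        = a∈
  ... | inj₂ (inj₁ refl) = b∈
  ... | inj₂ (inj₂ refl) = c∈

triple-swap : ∀ (a b c : Fin n) → triple a b c ≡ triple a c b
triple-swap a b c = cong (⁅ a ⁆ ∪_) (∪-comm ⁅ b ⁆ ⁅ c ⁆)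

triple-rotate : ∀ (a b c : Fin n) → triple a b c ≡ triple b c a
triple-rotate a b c = trans (∪-comm ⁅ a ⁆ _) (∪-assoc ⁅ b ⁆ ⁅ c ⁆ ⁅ a ⁆)

∣triple∣≡3 : ∀ {a b c : Fin n} → a ≢ b → a ≢ c → b ≢ c → ∣ triple a b c ∣ ≡ 3
∣triple∣≡3 {a = a} {b} {c} a≢b a≢c b≢c =
  trans (∣⁅x⁆∪p∣≡1+∣p∣ _ a∉) (cong suc (∣⁅x⁆∪⁅y⁆∣≡2 b≢c))
  where
  a∉ : a ∉ ⁅ b ⁆ ∪ ⁅ c ⁆
  a∉ = [ a≢b ∘ x∈⁅y⁆⇒x≡y b , a≢c ∘ x∈⁅y⁆⇒x≡y c ]′ ∘ x∈p∪q⁻ ⁅ b ⁆ ⁅ c ⁆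

-- 3-cycles as edges of a hypergraph

Cycle : Tournament n → Fin n → Fin n → Fin n → Set
Cycle T a b c = T .A a b × T .A b c × T .A c a

rotate : (T : Tournament n) → ∀ {a b c} → Cycle T a b c → Cycle T b c a
rotate T (ab , bc , ca) = bc , ca , ab

C₃-edge⁻ : (T : Tournament n) → ∀ {e} → C₃ T .E e →
           ∃[ a ] ∃[ b ] ∃[ c ] Cycle T a b c × e ≡ triple a b c
C₃-edge⁻ T {e} (_ , e⊆V , f , _ , onto , arcs) =
  f zero , f (suc zero) , f (suc (suc zero)) ,
  (arc 0⟶1 , arc 1⟶2 , arc 2⟶0) ,
  ⊆-antisym ⊆triple (triple-⊆ (image zero) (image (suc zero)) (image (suc (suc zero))))
  where
  arc : ∀ {i j} → i ⟶ j → T .A (f i) (f j)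
  arc {i} {j} ij = proj₁ (Equivalence.to (arcs i j) ij)
  image : ∀ i → f i ∈ e
  image i = Equivalence.from (onto (f i)) (i , refl)
  ⊆triple : e ⊆ triple (f zero) (f (suc zero)) (f (suc (suc zero)))
  ⊆triple {v} v∈ with Equivalence.to (onto v) v∈
  ... | zero             , refl = triple-1st
  ... | suc zero         , refl = triple-2nd
  ... | suc (suc zero)   , refl = triple-3rd

C₃-edge⁺ : (T : Tournament n) → ∀ {a b c} → Cycle T a b c → C₃ T .E (triple a b c)
C₃-edge⁺ {n = n} T {a} {b} {c} (ab , bc , ca) =
  ∣triple∣≡3 a≢b (c≢a ∘ sym) b≢c ,
  triple-⊆ (proj₁ (T .arc⊆V ab)) (proj₁ (T .arc⊆V bc)) (proj₁ (T .arc⊆V ca)) ,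
  f , injective _ _ , (λ v → mk⇔ onto (λ { (i , refl) → f∈ i })) , arcs
  where
  a≢b = arc-distinct T ab
  b≢c = arc-distinct T bc
  c≢a = arc-distinct T ca
  f : Fin 3 → Fin n
  f = a ∷ᶠ b ∷ᶠ c ∷ᶠ []ᶠ
  f∈ : ∀ i → f i ∈ triple a b c
  f∈ zero             = triple-1st
  f∈ (suc zero)       = triple-2nd
  f∈ (suc (suc zero)) = triple-3rd
  injective : ∀ i j → f i ≡ f j → i ≡ j
  injective zero             zero             _ = refl
  injective zero             (suc zero)       p = ⊥-elim (a≢b p)
  injective zero             (suc (suc zero)) p = ⊥-elim (c≢a (sym p))
  injective (suc zero)       zero             p = ⊥-elim (a≢b (sym p))
  injective (suc zero)       (suc zero)       _ = refl
  injective (suc zero)       (suc (suc zero)) p = ⊥-elim (b≢c p)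
  injective (suc (suc zero)) zero             p = ⊥-elim (c≢a p)
  injective (suc (suc zero)) (suc zero)       p = ⊥-elim (b≢c (sym p))
  injective (suc (suc zero)) (suc (suc zero)) _ = refl
  onto : ∀ {v} → v ∈ triple a b c → ∃[ i ] f i ≡ v
  onto v∈ with ∈triple⁻ v∈
  ... | inj₁ refl        = zero , refl
  ... | inj₂ (inj₁ refl) = suc zero , refl
  ... | inj₂ (inj₂ refl) = suc (suc zero) , refl
  arc⁻ : ∀ i j → T .A (f i) (f j) → i ⟶ j
  arc⁻ zero             zero             p = ⊥-elim (T .irrefl p)
  arc⁻ zero             (suc zero)       p = 0⟶1
  arc⁻ zero             (suc (suc zero)) p = ⊥-elim (arc-asym T ca p)
  arc⁻ (suc zero)       zero             p = ⊥-elim (arc-asym T ab p)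
  arc⁻ (suc zero)       (suc zero)       p = ⊥-elim (T .irrefl p)
  arc⁻ (suc zero)       (suc (suc zero)) p = 1⟶2
  arc⁻ (suc (suc zero)) zero             p = 2⟶0
  arc⁻ (suc (suc zero)) (suc zero)       p = ⊥-elim (arc-asym T bc p)
  arc⁻ (suc (suc zero)) (suc (suc zero)) p = ⊥-elim (T .irrefl p)
  arc⁺ : ∀ {i j} → i ⟶ j → T .A (f i) (f j)
  arc⁺ 0⟶1 = ab
  arc⁺ 1⟶2 = bc
  arc⁺ 2⟶0 = ca
  arcs : ∀ i j → _
  arcs i j = mk⇔ (λ ij → arc⁺ ij , f∈ i , f∈ j) (arc⁻ i j ∘ proj₁)

-- Once both triples start at `a`, the only freedom left is the order of the other two vertices.
cycle-from-1st : (T : Tournament n) → ∀ {a b c p q} → Cycle T a p q → triple a b c ≡ triple a p q →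
                 Cycle T a b c ⊎ Cycle T a c b
cycle-from-1st T cyc@(ap , pq , qa) eq
  with ∈triple⁻ (subst (_ ∈_) (sym eq) triple-2nd) | ∈triple⁻ (subst (_ ∈_) (sym eq) triple-3rd)
... | inj₁ refl        | _                = ⊥-elim (T .irrefl ap)
... | _                | inj₁ refl        = ⊥-elim (T .irrefl qa)
... | inj₂ (inj₁ refl) | inj₂ (inj₁ refl) = ⊥-elim (T .irrefl pq)
... | inj₂ (inj₁ refl) | inj₂ (inj₂ refl) = inj₁ cyc
... | inj₂ (inj₂ refl) | inj₂ (inj₁ refl) = inj₂ cyc
... | inj₂ (inj₂ refl) | inj₂ (inj₂ refl) = ⊥-elim (T .irrefl pq)

-- An elementary form of `Realizes`, equivalent to it by `realizes⁻` and `realizes⁺`. It spares the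
-- later arguments the isomorphisms and cardinalities inside `C₃`.
record CyclesOf (T : Tournament n) (H : Hypergraph n) : Set where
  field
    V≡         : T .V ≡ H .V
    edge⇒cycle : ∀ {e} → H .E e → ∃[ a ] ∃[ b ] ∃[ c ] Cycle T a b c × e ≡ triple a b c
    cycle⇒edge : ∀ {a b c} → Cycle T a b c → H .E (triple a b c)

  triple⇒cycle : ∀ {a b c} → H .E (triple a b c) → Cycle T a b c ⊎ Cycle T a c b
  triple⇒cycle {a} {b} {c} abc with edge⇒cycle abc
  ... | a′ , b′ , c′ , cyc , eq with ∈triple⁻ (subst (a ∈_) eq triple-1st)
  ...   | inj₁ refl        = cycle-from-1st T cyc eq
  ...   | inj₂ (inj₁ refl) =
    cycle-from-1st T (rotate T cyc) (trans eq (triple-rotate a′ b′ c′))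
  ...   | inj₂ (inj₂ refl) =
    cycle-from-1st T (rotate T (rotate T cyc))
      (trans eq (trans (triple-rotate a′ b′ c′) (triple-rotate b′ c′ a′)))

realizes⁻ : {T : Tournament n} {H : Hypergraph n} → T Realizes H → CyclesOf T H
realizes⁻ {T = T} (V≡ , _ , H⊆C , C⊆H) = record
  { V≡         = V≡
  ; edge⇒cycle = C₃-edge⁻ T ∘ H⊆C
  ; cycle⇒edge = C⊆H ∘ C₃-edge⁺ T
  }

realizes⁺ : {T : Tournament n} {H : Hypergraph n} → CyclesOf T H → T Realizes H
realizes⁺ {T = T} {H} R = V≡ , sym V≡ , H⊆C , C⊆H
  where
  open CyclesOf R
  H⊆C : ∀ {e} → H .E e → C₃ T .E e
  H⊆C e∈ with edge⇒cycle e∈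
  ... | _ , _ , _ , cyc , refl = C₃-edge⁺ T cyc
  C⊆H : ∀ {e} → C₃ T .E e → H .E e
  C⊆H e∈ with C₃-edge⁻ T e∈
  ... | _ , _ , _ , cyc , refl = cycle⇒edge cyc

dual-cycles : {T : Tournament n} {H : Hypergraph n} → CyclesOf T H → CyclesOf (dual T) H
dual-cycles {T = T} {H} R = record
  { V≡         = V≡
  ; edge⇒cycle = flipped ∘ edge⇒cycle
  ; cycle⇒edge = λ { {a} {b} {c} (ba , cb , ac) →
      subst (H .E) (triple-swap a c b) (cycle⇒edge (ac , cb , ba)) }
  }
  where
  open CyclesOf R
  flipped : ∀ {e} → ∃[ a ] ∃[ b ] ∃[ c ] Cycle T a b c × e ≡ triple a b c →
            ∃[ a ] ∃[ b ] ∃[ c ] Cycle (dual T) a b c × e ≡ triple a b c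
  flipped (a , b , c , (ab , bc , ca) , eq) =
    a , c , b , (ca , bc , ab) , trans eq (triple-swap a b c)

-- Primality of a hypergraph and of its realizations

missed⇒module : (K : Hypergraph n) → ∀ {c} → (∀ {e} → K .E e → c ∉ e) → IsModule K (K .V - c)
missed⇒module K {c} missed = p─q⊆p (K .V) ⁅ c ⁆ , λ e e∈ _ (v , v∈) →
  ⊥-elim (x∈p─q⇒x∉q e (K .V - c) v∈
    (x∈p∧x≢y⇒x∈p-y (K .edge⊆V e∈ (p─q⊆p e (K .V - c) v∈))
      (λ { refl → missed e∈ (p─q⊆p e (K .V - c) v∈) })))

-- If no edge contains `c`, no edge leaves `V - c`, which is then a module; having at least two
-- vertices and missing `c`, it is nontrivial.
prime-covered : {K : Hypergraph n} → Prime K → ∀ {c} → c ∈ K .V →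
                ¬ (∀ {e} → K .E e → c ∉ e)
prime-covered {K = K} (3≤ , trivial) {c} c∈ missed
  with trivial (K .V - c) (missed⇒module K missed)
... | inj₂ (inj₁ eq) = x∈p-y⇒x≢y (K .V) (subst (c ∈_) (sym eq) c∈) refl
... | inj₁ eq = contradiction (≤-trans 3≤ (≤-trans (p⊆q⇒∣p∣≤∣q∣ V⊆) (≤-reflexive (∣⁅x⁆∣≡1 c))))
                  λ { (s≤s ()) }
  where
  V⊆ : K .V ⊆ ⁅ c ⁆
  V⊆ {v} v∈ with v ≟ c
  ... | yes refl = x∈⁅x⁆ c
  ... | no v≢c   = ⊥-elim (∉⊥ (subst (v ∈_) eq (x∈p∧x≢y⇒x∈p-y v∈ v≢c)))
... | inj₂ (inj₂ (u , u∈ , eq)) =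
  contradiction (≤-trans 3≤ (≤-trans (p⊆q⇒∣p∣≤∣q∣ V⊆) (≤-reflexive (∣⁅x⁆∪⁅y⁆∣≡2 (u≢c ∘ sym)))))
    λ { (s≤s (s≤s ())) }
  where
  u≢c : u ≢ c
  u≢c = x∈p-y⇒x≢y (K .V) (subst (u ∈_) (sym eq) (x∈⁅x⁆ u))
  V⊆ : K .V ⊆ ⁅ c ⁆ ∪ ⁅ u ⁆
  V⊆ {v} v∈ with v ≟ c
  ... | yes refl = x∈p∪q⁺ (inj₁ (x∈⁅x⁆ c))
  ... | no v≢c   = x∈p∪q⁺ (inj₂ (subst (v ∈_) eq (x∈p∧x≢y⇒x∈p-y v∈ v≢c)))

-- An edge crossing `M` is a 3-cycle that enters `M` at some `a` from some `c`. The vertex `b` after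
-- `a` lies outside `M`, since otherwise `c` would send an arc to `b` as it does to `a`. So `a` is
-- the only common vertex, and any `k` in `M` can replace it in the 3-cycle.
tmodule⇒module : {T : Tournament n} {K : Hypergraph n} → CyclesOf T K →
                 ∀ {M} → IsTModule T (T .V) M → IsModule K M
tmodule⇒module {T = T} {K} R {M} (M⊆V , out) =
  (λ v∈ → subst (_ ∈_) V≡ (M⊆V v∈)) , substitute
  where
  open CyclesOf R

  Goal : Subset _ → Set
  Goal e = ∃[ m ] m ∈ M × e ∩ M ≡ ⁅ m ⁆ × (∀ k → k ∈ M → K .E ((e - m) ∪ ⁅ k ⁆))

  enters-at : ∀ {a b c e} → Cycle T a b c → e ≡ triple a b c → a ∈ M → c ∉ M → Goal e
  enters-at {a} {b} {c} (ab , bc , ca) refl a∈ c∉ = a , a∈ , ⊆-antisym ⊆a a⊆ , swapped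
    where
    e = triple a b c
    b∉ : b ∉ M
    b∉ b∈ = arc-asym T bc (out (proj₁ (T .arc⊆V ca)) c∉ a∈ b∈ ca)
    ⊆a : e ∩ M ⊆ ⁅ a ⁆
    ⊆a v∈ with x∈p∩q⁻ e M v∈
    ... | v∈e , v∈M with ∈triple⁻ v∈e
    ...   | inj₁ refl        = x∈⁅x⁆ a
    ...   | inj₂ (inj₁ refl) = ⊥-elim (b∉ v∈M)
    ...   | inj₂ (inj₂ refl) = ⊥-elim (c∉ v∈M)
    a⊆ : ⁅ a ⁆ ⊆ e ∩ M
    a⊆ v∈ with x∈⁅y⁆⇒x≡y a v∈
    ... | refl = x∈p∩q⁺ (triple-1st , a∈)
    swapped : ∀ k → k ∈ M → K .E ((e - a) ∪ ⁅ k ⁆)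
    swapped k k∈ = subst (K .E) (⊆-antisym ⊆₁ ⊆₂) (cycle⇒edge (kb , bc , ck))
      where
      kb : T .A k b
      kb = IsTModule-in T (λ v∈ → v∈) (M⊆V , out) (proj₁ (T .arc⊆V bc)) b∉ a∈ k∈ ab
      ck : T .A c k
      ck = out (proj₁ (T .arc⊆V ca)) c∉ a∈ k∈ ca
      ⊆₁ : triple k b c ⊆ (e - a) ∪ ⁅ k ⁆
      ⊆₁ = triple-⊆ (x∈p∪q⁺ (inj₂ (x∈⁅x⁆ k)))
        (x∈p∪q⁺ (inj₁ (x∈p∧x≢y⇒x∈p-y triple-2nd (λ { refl → b∉ a∈ }))))
        (x∈p∪q⁺ (inj₁ (x∈p∧x≢y⇒x∈p-y triple-3rd (λ { refl → c∉ a∈ }))))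
      ⊆₂ : (e - a) ∪ ⁅ k ⁆ ⊆ triple k b c
      ⊆₂ v∈ with x∈p∪q⁻ (e - a) ⁅ k ⁆ v∈
      ... | inj₂ v∈k with x∈⁅y⁆⇒x≡y k v∈k
      ...   | refl = triple-1st
      ⊆₂ v∈ | inj₁ v∈e-a with ∈triple⁻ (p─q⊆p e ⁅ a ⁆ v∈e-a)
      ...   | inj₁ v≡a         = ⊥-elim (x∈p-y⇒x≢y e v∈e-a v≡a)
      ...   | inj₂ (inj₁ refl) = triple-2nd
      ...   | inj₂ (inj₂ refl) = triple-3rd

  substitute : ∀ e → K .E e → Nonempty (e ∩ M) → Nonempty (e ─ M) → Goal e
  substitute e e∈ (p , p∈) (q , q∈) with edge⇒cycle e∈
  ... | a , b , c , cyc , refl with a ∈? M | b ∈? M | c ∈? M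
  ... | yes a∈ | _      | no c∉  = enters-at cyc refl a∈ c∉
  ... | no a∉  | yes b∈ | _      = enters-at (rotate T cyc) (triple-rotate a b c) b∈ a∉
  ... | _      | no b∉  | yes c∈ =
    enters-at (rotate T (rotate T cyc)) (trans (triple-rotate a b c) (triple-rotate b c a)) c∈ b∉
  ... | yes a∈ | yes b∈ | yes c∈ =
    ⊥-elim (x∈p─q⇒x∉q e M q∈ (triple-⊆ a∈ b∈ c∈ (p─q⊆p e M q∈)))
  ... | no a∉  | no b∉  | no c∉  with x∈p∩q⁻ e M p∈
  ...   | p∈e , p∈M with ∈triple⁻ p∈e
  ...     | inj₁ refl        = ⊥-elim (a∉ p∈M)
  ...     | inj₂ (inj₁ refl) = ⊥-elim (b∉ p∈M)
  ...     | inj₂ (inj₂ refl) = ⊥-elim (c∉ p∈M)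

prime⇒tprime : {T : Tournament n} {K : Hypergraph n} → CyclesOf T K → Prime K → TPrime T
prime⇒tprime {T = T} R (_ , trivial) M mod {a} {b} a∈ b∈ a≢b
  with trivial M (tmodule⇒module R mod)
... | inj₁ refl                   = ⊥-elim (∉⊥ a∈)
... | inj₂ (inj₁ refl)            = subst (_ ∈_) (CyclesOf.V≡ R)
... | inj₂ (inj₂ (v , _ , refl))  =
  ⊥-elim (a≢b (trans (x∈⁅y⁆⇒x≡y v a∈) (sym (x∈⁅y⁆⇒x≡y v b∈))))

-- Rigidity of realizations

module Rigidity {T S : Tournament n} {K : Hypergraph n} (prime : Prime K)
  (RT : CyclesOf T K) (RS : CyclesOf S K) where

  T⊆S : T .V ⊆ S .V
  T⊆S = subst (_ ∈_) (trans (CyclesOf.V≡ RT) (sym (CyclesOf.V≡ RS)))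

  transfer : ∀ {a b c} → Cycle T a b c → Cycle S a b c ⊎ Cycle S a c b
  transfer = CyclesOf.triple⇒cycle RS ∘ CyclesOf.cycle⇒edge RT

  transfer⁻ : ∀ {a b c} → Cycle S a b c → Cycle T a b c ⊎ Cycle T a c b
  transfer⁻ = CyclesOf.triple⇒cycle RT ∘ CyclesOf.cycle⇒edge RS

  Disagree : Rel (Fin n) 0ℓ
  Disagree u v = (T .A u v × S .A v u) ⊎ (T .A v u × S .A u v)

  disagree? : Decidable Disagree
  disagree? u v = (arc? T u v ×-dec arc? S v u) ⊎-dec (arc? T v u ×-dec arc? S u v)

  total : ∀ {u v} → T .A u v → S .A u v ⊎ S .A v u
  total uv = arc-total S (T⊆S (proj₁ (T .arc⊆V uv))) (T⊆S (proj₂ (T .arc⊆V uv))) (arc-distinct T uv)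

  agree⁺ : ∀ {u v} → T .A u v → ¬ Disagree u v → S .A u v
  agree⁺ uv ¬d with total uv
  ... | inj₁ uv′ = uv′
  ... | inj₂ vu′ = ⊥-elim (¬d (inj₁ (uv , vu′)))

  disagree⁺ : ∀ {u v} → T .A u v → Disagree u v → S .A v u
  disagree⁺ uv (inj₁ (_ , vu′)) = vu′
  disagree⁺ uv (inj₂ (vu , _))  = ⊥-elim (arc-asym T uv vu)

  -- Each 3-cycle of `T` is kept or reversed as a whole by `S`, which gives `cyc`. A violation of
  -- one of the other two laws would make `a b c` carry a 3-cycle in exactly one of `T` and `S`.
  colouring : Colouring T
  colouring = record
    { D    = Disagree
    ; D?   = disagree?
    ; symm = [ inj₂ , inj₁ ]′
    ; cyc  = cyc
    ; tr₀  = tr₀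
    ; tr₁  = tr₁
    }
    where
    cyc : ∀ {a b c} → T .A a b → T .A b c → T .A c a → Disagree a b → Disagree b c
    cyc ab bc ca d with transfer (ab , bc , ca)
    ... | inj₁ (ab′ , _)     = ⊥-elim (arc-asym S ab′ (disagree⁺ ab d))
    ... | inj₂ (_ , cb′ , _) = inj₁ (bc , cb′)
    tr₀ : ∀ {a b c} → T .A a b → T .A b c → ¬ Disagree a b → ¬ Disagree b c → ¬ Disagree a c
    tr₀ ab bc ¬ab ¬bc (inj₁ (ac , ca′)) with transfer⁻ (agree⁺ ab ¬ab , agree⁺ bc ¬bc , ca′)
    ... | inj₁ (_ , _ , ca) = arc-asym T ac ca
    ... | inj₂ (_ , cb , _) = arc-asym T bc cb
    tr₀ ab bc ¬ab ¬bc (inj₂ (ca , ac′)) with transfer (ab , bc , ca)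
    ... | inj₁ (_ , _ , ca′) = arc-asym S ac′ ca′
    ... | inj₂ (_ , cb′ , _) = arc-asym S (agree⁺ bc ¬bc) cb′
    tr₁ : ∀ {a b c} → T .A a b → T .A b c → Disagree a b → Disagree b c → Disagree a c
    tr₁ ab bc dab dbc
      with arc-total T (proj₁ (T .arc⊆V ab)) (proj₂ (T .arc⊆V bc)) (λ { refl → arc-asym T ab bc })
    ... | inj₁ ac with total ac
    ...   | inj₂ ca′ = inj₁ (ac , ca′)
    ...   | inj₁ ac′ with transfer⁻ (ac′ , disagree⁺ bc dbc , disagree⁺ ab dab)
    ...     | inj₁ (_ , cb , _) = ⊥-elim (arc-asym T bc cb)
    ...     | inj₂ (_ , _ , ca) = ⊥-elim (arc-asym T ac ca)
    tr₁ ab bc dab dbc | inj₂ ca with transfer (ab , bc , ca)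
    ...   | inj₁ (ab′ , _)    = ⊥-elim (arc-asym S (disagree⁺ ab dab) ab′)
    ...   | inj₂ (ac′ , _)    = inj₂ (ca , ac′)

  -- A prime hypergraph has a vertex, and every vertex of it lies in an edge.
  has-cycle : ∃[ a ] ∃[ b ] ∃[ c ] Cycle T a b c
  has-cycle with any? (λ a → any? λ b → any? λ c → arc? T a b ×-dec arc? T b c ×-dec arc? T c a)
  ... | yes found = found
  ... | no none   = ⊥-elim (prime-covered {K = K} prime (proj₂ V-nonempty)
    (λ e∈ _ → none (let a , b , c , cyc , _ = CyclesOf.edge⇒cycle RT e∈ in a , b , c , cyc)))
    where
    V-nonempty : Nonempty (K .V)
    V-nonempty with nonempty? (K .V)
    ... | yes v = v
    ... | no empty = contradiction
      (subst (3 ≤_) (trans (cong ∣_∣ (Empty-unique empty)) (∣⊥∣≡0 n)) (proj₁ prime)) λ ()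

  strong-cycle : ∀ {a b c} → Cycle T a b c → Strong T (triple a b c)
  strong-cycle {a} {b} {c} (ab , bc , ca) P P? p∈ pp q∈ ¬pq cut with P? a | P? b | P? c
  ... | yes pa | _      | no ¬pc = arc-asym T ca (cut triple-1st triple-3rd pa ¬pc)
  ... | no ¬pa | yes pb | _      = arc-asym T ab (cut triple-2nd triple-1st pb ¬pa)
  ... | _      | no ¬pb | yes pc = arc-asym T bc (cut triple-3rd triple-2nd pc ¬pb)
  ... | yes pa | yes pb | yes pc with ∈triple⁻ q∈
  ...   | inj₁ refl        = ¬pq pa
  ...   | inj₂ (inj₁ refl) = ¬pq pb
  ...   | inj₂ (inj₂ refl) = ¬pq pc
  strong-cycle _ P P? p∈ pp q∈ ¬pq cut | no ¬pa | no ¬pb | no ¬pc with ∈triple⁻ p∈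
  ...   | inj₁ refl        = ¬pa pp
  ...   | inj₂ (inj₁ refl) = ¬pb pp
  ...   | inj₂ (inj₂ refl) = ¬pc pp

  -- Kept general in `L` so as to serve for the disagreeing pairs and for their complement. One
  -- non-black arc makes the whole 3-cycle non-black, and growth starts there.
  spread : (L : Colouring T) → ∀ {a b c} → Cycle T a b c → ¬ Colouring.D L a b →
           ∀ {u v} → u ∈ T .V → v ∈ T .V → u ≢ v → ¬ Colouring.D L u v
  spread L {a} {b} {c} (ab , bc , ca) ¬ab =
    grow-mono T (prime⇒tprime RT prime) L (⊃-wellFounded _)
      (triple-⊆ (proj₁ (T .arc⊆V ab)) (proj₁ (T .arc⊆V bc)) (proj₁ (T .arc⊆V ca)))
      (strong-cycle (ab , bc , ca)) mono triple-1st triple-2nd (arc-distinct T ab)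
    where
    open Colouring L
    ¬ca : ¬ D c a
    ¬ca = ¬ab ∘ cyc ca ab bc
    ¬bc : ¬ D b c
    ¬bc = ¬ca ∘ cyc bc ca ab
    mono : ∀ {u v} → u ∈ triple a b c → v ∈ triple a b c → u ≢ v → ¬ D u v
    mono u∈ v∈ u≢v with ∈triple⁻ u∈ | ∈triple⁻ v∈
    ... | inj₁ refl        | inj₁ refl        = ⊥-elim (u≢v refl)
    ... | inj₁ refl        | inj₂ (inj₁ refl) = ¬ab
    ... | inj₁ refl        | inj₂ (inj₂ refl) = ¬ca ∘ symm
    ... | inj₂ (inj₁ refl) | inj₁ refl        = ¬ab ∘ symm
    ... | inj₂ (inj₁ refl) | inj₂ (inj₁ refl) = ⊥-elim (u≢v refl)
    ... | inj₂ (inj₁ refl) | inj₂ (inj₂ refl) = ¬bc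
    ... | inj₂ (inj₂ refl) | inj₁ refl        = ¬ca
    ... | inj₂ (inj₂ refl) | inj₂ (inj₁ refl) = ¬bc ∘ symm
    ... | inj₂ (inj₂ refl) | inj₂ (inj₂ refl) = ⊥-elim (u≢v refl)

  Arcs⊆ : Tournament n → Tournament n → Set
  Arcs⊆ P Q = ∀ {u v} → P .A u v → Q .A u v

  rigid : Arcs⊆ T S ⊎ Arcs⊆ T (dual S)
  rigid with has-cycle
  -- If `S` keeps the arc `ab`, no pair disagrees; if `S` reverses it, the complementary colouring
  -- shows that all pairs do.
  ... | a , b , c , cyc with disagree? a b
  ...   | no ¬ab = inj₁ λ uv → agree⁺ uv
          (spread colouring cyc ¬ab (proj₁ (T .arc⊆V uv)) (proj₂ (T .arc⊆V uv)) (arc-distinct T uv))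
  ...   | yes ab = inj₂ λ uv → disagree⁺ uv (decidable-stable (disagree? _ _)
          (spread (complement colouring) cyc (λ ¬ab → ¬ab ab)
            (proj₁ (T .arc⊆V uv)) (proj₂ (T .arc⊆V uv)) (arc-distinct T uv)))

-- An arc of `Q` missing from `P` is reversed in `P`, and would occur in both directions in `Q`.
arcs⊆⇒≈ : {P Q : Tournament n} → P .V ≡ Q .V → (∀ {u v} → P .A u v → Q .A u v) → P ≈ᵀ Q
arcs⊆⇒≈ {P = P} {Q} V≡ P⊆Q = V≡ , P⊆Q , Q⊆P
  where
  Q⊆P : ∀ {u v} → Q .A u v → P .A u v
  Q⊆P uv with arc-total P (subst (_ ∈_) (sym V≡) (proj₁ (Q .arc⊆V uv)))
                          (subst (_ ∈_) (sym V≡) (proj₂ (Q .arc⊆V uv))) (arc-distinct Q uv)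
  ... | inj₁ uv′ = uv′
  ... | inj₂ vu  = ⊥-elim (arc-asym Q uv (P⊆Q vu))

rigidity : {T S : Tournament n} {K : Hypergraph n} → Prime K → CyclesOf T K → CyclesOf S K →
           T ≈ᵀ S ⊎ T ≈ᵀ dual S
rigidity {T = T} {S} {K} prime RT RS with Rigidity.rigid {K = K} prime RT RS
... | inj₁ T⊆S = inj₁ (arcs⊆⇒≈ {P = T} {S} V≡ T⊆S)
  where V≡ = trans (CyclesOf.V≡ RT) (sym (CyclesOf.V≡ RS))
... | inj₂ T⊆S = inj₂ (arcs⊆⇒≈ {P = T} {dual S} V≡ T⊆S)
  where V≡ = trans (CyclesOf.V≡ RT) (sym (CyclesOf.V≡ RS))

-- Paths, closures and components

module _ {n : ℕ} {R : Rel (Fin n) 0ℓ} {I : Pred (Fin n) 0ℓ} where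

  -- Only the target has to satisfy `I`: the sequences defining `Y⁻` and `Y⁺` start in a block and
  -- are isolated from their second vertex on.
  Step : Rel (Fin n) 0ℓ
  Step u w = R u w × I w

  sequence⇒star : ∀ k (s : Fin (suc k) → Fin n) → (∀ (i : Fin k) → I (s (suc i))) →
                  (∀ (i : Fin k) → R (s (inject₁ i)) (s (suc i))) →
                  Star Step (s zero) (s (fromℕ k))
  sequence⇒star ℕ.zero  s _  _  = ε
  sequence⇒star (suc k) s is rs =
    (rs zero , is zero) ◅ sequence⇒star k (s ∘ suc) (is ∘ suc) (rs ∘ suc)

  star⇒sequence : ∀ {u v} → Star Step u v →
    ∃[ k ] Σ[ s ∈ (Fin (suc k) → Fin n) ]
      s zero ≡ u × s (fromℕ k) ≡ v × (∀ (i : Fin k) → I (s (suc i)))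
    × (∀ (i : Fin k) → R (s (inject₁ i)) (s (suc i)))
  star⇒sequence {u} ε = 0 , (λ _ → u) , refl , refl , (λ ()) , (λ ())
  star⇒sequence {u} ((uw , iw) ◅ path) with star⇒sequence path
  ... | k , s , refl , end , is , rs =
    suc k , u ∷ᶠ s , refl , end , (λ { zero → iw ; (suc i) → is i })
          , (λ { zero → uw ; (suc i) → rs i })

-- Vertices one step away are added one at a time, each with its path from `S₀`; by finiteness this
-- ends in a closed set.
closure : {R : Rel (Fin n) 0ℓ} → Decidable R → ∀ S₀ → ∃[ S ] S₀ ⊆ S
  × (∀ {v} → v ∈ S → ∃[ u ] u ∈ S₀ × Star R u v)
  × (∀ {u v} → u ∈ S → R u v → v ∈ S)
closure {n = n} {R = R} R? S₀ = go (⊃-wellFounded S₀) (λ v∈ → v∈) (λ v∈ → _ , v∈ , ε)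
  where
  Reached : Subset n → Set
  Reached S = ∀ {v} → v ∈ S → ∃[ u ] u ∈ S₀ × Star R u v

  go : ∀ {S} → Acc _⊃_ S → S₀ ⊆ S → Reached S →
       ∃[ S′ ] S₀ ⊆ S′ × Reached S′ × (∀ {u v} → u ∈ S′ → R u v → v ∈ S′)
  go {S} (acc rec) S₀⊆S reached
    with any? (λ u → any? λ v → (u ∈? S) ×-dec R? u v ×-dec ¬? (v ∈? S))
  ... | no none = S , S₀⊆S , reached ,
    λ {u} {v} u∈ uv → decidable-stable (v ∈? S) (λ v∉ → none (u , v , u∈ , uv , v∉))
  ... | yes (u , v , u∈ , uv , v∉) =
    go (rec (p⊆p∪q ⁅ v ⁆ , v , q⊆p∪q S ⁅ v ⁆ (x∈⁅x⁆ v) , v∉)) (p⊆p∪q ⁅ v ⁆ ∘ S₀⊆S) reached′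
    where
    reached′ : Reached (S ∪ ⁅ v ⁆)
    reached′ w∈ with x∈p∪q⁻ S ⁅ v ⁆ w∈
    ... | inj₁ w∈S = reached w∈S
    ... | inj₂ w∈v with x∈⁅y⁆⇒x≡y v w∈v | reached u∈
    ...   | refl | r , r∈ , path = r , r∈ , path ◅◅ (uv ◅ ε)

-- The set reached from `v` is closed under adjacency, so no connected set containing it can leave
-- it.
component-of : (G : Graph n) → Decidable (Graph.Adj G) → ∀ {v} → v ∈ Graph.V G →
  ∃[ C ] Σ[ C⊆V ∈ C ⊆ Graph.V G ] IsComponent G C C⊆V × v ∈ C
  × (∀ {u w} → u ∈ C → Graph.Adj G u w → w ∈ C)
component-of {n = n} G adj? {v} v∈ with closure adj? ⁅ v ⁆
... | C , v⊆C , reached , closed =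
  C , C⊆V , ((( v , v∈C ) , connected) , maximal) , v∈C , closed
  where
  open Graph G hiding (V)
  v∈C : v ∈ C
  v∈C = v⊆C (x∈⁅x⁆ v)
  from-v : ∀ {w} → w ∈ C → Star Adj v w
  from-v w∈ with reached w∈
  ... | u , u∈ , path = subst (λ r → Star Adj r _) (x∈⁅y⁆⇒x≡y v u∈) path
  target∈V : ∀ {u w} → u ∈ Graph.V G → Star Adj u w → w ∈ Graph.V G
  target∈V u∈ ε = u∈
  target∈V u∈ (uw ◅ path) = target∈V (proj₂ (adj⊆V uw)) path
  C⊆V : C ⊆ Graph.V G
  C⊆V w∈ = target∈V v∈ (from-v w∈)
  inside-C : ∀ {u w} → u ∈ C → Star Adj u w → Star (Graph.Adj (inducedᴳ G C C⊆V)) u w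
  inside-C u∈ ε = ε
  inside-C u∈ (uw ◅ path) = (uw , u∈ , closed u∈ uw) ◅ inside-C (closed u∈ uw) path
  connected : ∀ a b → a ∈ C → b ∈ C → Star (Graph.Adj (inducedᴳ G C C⊆V)) a b
  connected a b a∈ b∈ =
    reverse (Graph.symm (inducedᴳ G C C⊆V)) (inside-C v∈C (from-v a∈)) ◅◅ inside-C v∈C (from-v b∈)
  maximal : ∀ D (D⊆V : D ⊆ Graph.V G) → Connected (inducedᴳ G D D⊆V) → C ⊆ D → D ≡ C
  maximal D D⊆V (_ , paths) C⊆D =
    ⊆-antisym (λ {d} d∈ → stays v∈C (paths v d (C⊆D v∈C) d∈)) C⊆D
    where
    stays : ∀ {u w} → u ∈ C → Star (Graph.Adj (inducedᴳ G D D⊆V)) u w → w ∈ C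
    stays u∈ ε = u∈
    stays u∈ ((uw , _) ◅ path) = stays (closed u∈ uw) path

other-element : (C : Subset n) → 2 ≤ ∣ C ∣ → ∀ v → ∃[ w ] w ∈ C × w ≢ v
other-element C 2≤ v with any? (λ w → (w ∈? C) ×-dec ¬? (w ≟ v))
... | yes found = found
... | no none = contradiction
  (≤-trans 2≤ (≤-trans (p⊆q⇒∣p∣≤∣q∣ C⊆v) (≤-reflexive (∣⁅x⁆∣≡1 v)))) λ { (s≤s ()) }
  where
  C⊆v : C ⊆ ⁅ v ⁆
  C⊆v {w} w∈ with w ≟ v
  ... | yes refl = x∈⁅x⁆ w
  ... | no w≢v   = ⊥-elim (none (w , w∈ , w≢v))

component-neighbour : (G : Graph n) → ∀ C (C⊆V : C ⊆ Graph.V G) → IsComponent G C C⊆V → 2 ≤ ∣ C ∣ →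
                      ∀ {v} → v ∈ C → ∃[ w ] w ∈ C × Graph.Adj G v w
component-neighbour G C C⊆V ((_ , paths) , _) 2≤ {v} v∈ with other-element C 2≤ v
... | w , w∈ , w≢v with paths v w v∈ w∈
...   | ε = ⊥-elim (w≢v refl)
...   | _◅_ {j = u} (vu , _ , u∈) _ = u , u∈ , vu

-- The graph `Gₓ` and the realizations that restrict to `Tₓ`

module Link (H : Hypergraph n) (x : Fin n) where

  open Graph (link H x) public using (Adj)

  V-x : Subset n
  V-x = Hypergraph.V H - x

  adj? : Decidable Adj
  adj? v w = ((v ∈? V-x) ×-dec (w ∈? V-x)) ×-dec ¬? (v ≟ w) ×-dec H .E? (triple x v w)

  symmetric : ∀ {v w} → Adj v w → Adj w v
  symmetric = Graph.symm (link H x)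

  Iso : Pred (Fin n) 0ℓ
  Iso = Isolated (link H x)

  iso? : U.Decidable Iso
  iso? v = (v ∈? V-x) ×-dec all? (λ w → ¬? (adj? v w))

  adj⇒¬iso : ∀ {v w} → Adj v w → ¬ Iso v
  adj⇒¬iso vw (_ , alone) = alone _ vw

  neighbour : ∀ {v} → v ∈ V-x → ¬ Iso v → ∃[ w ] Adj v w
  neighbour {v} v∈ ¬iso with any? (adj? v)
  ... | yes found = found
  ... | no none = ⊥-elim (¬iso (v∈ , λ w vw → none (w , vw)))

  x∉V-x : x ∉ V-x
  x∉V-x x∈ = x∈p-y⇒x≢y (H .V) x∈ refl

  module _ (Tₓ : Tournament n) where

    open Conditions H x Tₓ using (Y⁻)

    Y⁻-intro : ∀ {X⁻ u v} → Iso v → u ∈ X⁻ → Star (Step {R = Tₓ .A} {I = Iso}) u v → Y⁻ X⁻ v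
    Y⁻-intro iv u∈ path with star⇒sequence path
    ... | k , s , refl , end , is , rs = iv , k , s , u∈ , end , is , rs

    Y⁻-elim : ∀ {X⁻ v} → Y⁻ X⁻ v → ∃[ u ] u ∈ X⁻ × Star (Step {R = Tₓ .A} {I = Iso}) u v
    Y⁻-elim (iv , k , s , s₀∈ , refl , is , rs) = s zero , s₀∈ , sequence⇒star k s is rs

  -- A pointwise form of the equation between `T -ᵀ x` and `Tₓ`, in which reversing all arcs is
  -- immediate.
  record Restriction (Tₓ T : Tournament n) : Set where
    field
      cycles : CyclesOf T H
      to-x   : ∀ {u v} → u ∈ V-x → v ∈ V-x → T .A u v → Tₓ .A u v
      from-x : ∀ {u v} → Tₓ .A u v → T .A u v

  restriction : {Tₓ T : Tournament n} → CyclesOf T H → (T -ᵀ x) ≈ᵀ Tₓ → Restriction Tₓ T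
  restriction {T = T} R (_ , to , from) = record
    { cycles = R
    ; to-x   = λ u∈ v∈ uv → to (uv , subst (λ W → _ ∈ W - x) (sym V≡) u∈
                                  , subst (λ W → _ ∈ W - x) (sym V≡) v∈)
    ; from-x = proj₁ ∘ from
    }
    where open CyclesOf R

  -- `Y⁻` formed with `dual Tₓ` unfolds to `Y⁺` formed with `Tₓ`. Hence every fact below about the
  -- out-neighbours of `x` also yields the one about its in-neighbours.
  restriction-dual : {Tₓ T : Tournament n} → Restriction Tₓ T → Restriction (dual Tₓ) (dual T)
  restriction-dual r = record
    { cycles = dual-cycles cycles
    ; to-x   = λ u∈ v∈ → to-x v∈ u∈
    ; from-x = from-x
    }
    where open Restriction r

  module Restricted (x∈ : x ∈ H .V) {Tₓ T : Tournament n} (r : Restriction Tₓ T) where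

    open Restriction r
    open CyclesOf cycles
    open Conditions H x Tₓ using (Y⁻)

    arc∈V-x : ∀ {u} → (T .A x u ⊎ T .A u x) → u ∈ V-x
    arc∈V-x (inj₁ xu) =
      x∈p∧x≢y⇒x∈p-y (subst (_ ∈_) V≡ (proj₂ (T .arc⊆V xu))) (arc-distinct T xu ∘ sym)
    arc∈V-x (inj₂ ux) =
      x∈p∧x≢y⇒x∈p-y (subst (_ ∈_) V≡ (proj₁ (T .arc⊆V ux))) (arc-distinct T ux)

    V-x⊆V : ∀ {u} → u ∈ V-x → u ∈ T .V
    V-x⊆V u∈ = subst (_ ∈_) (sym V≡) (p─q⊆p (H .V) ⁅ x ⁆ u∈)

    at-x : ∀ {u} → u ∈ V-x → T .A x u ⊎ T .A u x
    at-x u∈ = arc-total T (subst (x ∈_) (sym V≡) x∈) (V-x⊆V u∈) (λ { refl → x∉V-x u∈ })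

    adj⇒cycle : ∀ {v w} → Adj v w → Cycle T x v w ⊎ Cycle T x w v
    adj⇒cycle (_ , _ , e) = triple⇒cycle e

    cycle⇒adj : ∀ {v w} → Cycle T x v w → Adj v w
    cycle⇒adj cyc@(xv , vw , wx) =
      (arc∈V-x (inj₁ xv) , arc∈V-x (inj₂ wx)) , arc-distinct T vw , cycle⇒edge cyc

    -- The arc `u → v` would close a 3-cycle through `x` and make `u` and `v` adjacent in `Gₓ`,
    -- while one of them is isolated.
    opposite : ∀ {v u} → T .A v x → T .A x u → Iso v ⊎ Iso u → T .A v u
    opposite {v} {u} vx xu iso
      with arc-total T (proj₁ (T .arc⊆V vx)) (proj₂ (T .arc⊆V xu)) (λ { refl → arc-asym T vx xu })
    ... | inj₁ vu = vu
    ... | inj₂ uv = ⊥-elim ([ adj⇒¬iso (symmetric uv-adj) , adj⇒¬iso uv-adj ]′ iso)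
      where uv-adj = cycle⇒adj (xu , uv , vx)

    oppositeₓ : ∀ {v u} → T .A v x → T .A x u → Iso v ⊎ Iso u → Tₓ .A v u
    oppositeₓ vx xu iso = to-x (arc∈V-x (inj₂ vx)) (arc∈V-x (inj₁ xu)) (opposite vx xu iso)

    -- If the next vertex `w` had an arc to `x`, then `opposite` would give `w → u` against the arc
    -- `u → w` of the path.
    out-along : ∀ {u v} → Star (Step {R = Tₓ .A} {I = Iso}) u v → T .A x u → T .A x v
    out-along ε xu = xu
    out-along ((uw , iw) ◅ path) xu with at-x (proj₁ iw)
    ... | inj₁ xw = out-along path xw
    ... | inj₂ wx = ⊥-elim (arc-asym T (from-x uw) (opposite wx xu (inj₁ iw)))

    Y⁻-out : ∀ {X⁻ v} → (∀ {u} → u ∈ X⁻ → T .A x u) → Y⁻ X⁻ v → T .A x v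
    Y⁻-out x→X⁻ y with Y⁻-elim Tₓ y
    ... | u , u∈ , path = out-along path (x→X⁻ u∈)

    Out : Pred (Fin n) 0ℓ
    Out v = T .A x v × ¬ Iso v

    out? : U.Decidable Out
    out? v = arc? T x v ×-dec ¬? (iso? v)

    X⁻ₒ : Subset n
    X⁻ₒ = comprehension out?

    -- The vertices z with x → z that are not reached from X⁻ form, together
    -- with x, a module.
    out⇒Y⁻ : TPrime T → Nonempty X⁻ₒ → ∀ {v} → Iso v → T .A x v → Y⁻ X⁻ₒ v
    out⇒Y⁻ prime (p , p∈) {v} iv xv with closure (λ u w → arc? Tₓ u w ×-dec iso? w) X⁻ₒ
    ... | S , X⁻⊆S , reached , closed with v ∈? S
    ...   | yes v∈ = let u , u∈ , path = reached v∈ in Y⁻-intro Tₓ iv u∈ path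
    ...   | no v∉  = ⊥-elim (p∉M (prime M (M⊆V , out) (M⁺ (inj₁ refl)) (M⁺ (inj₂ (iv , xv , v∉)))
                       (arc-distinct T xv) (proj₂ (T .arc⊆V (proj₁ (∈-comprehension⁻ out? p∈))))))
      where
      InM : Pred (Fin n) 0ℓ
      InM w = w ≡ x ⊎ (Iso w × T .A x w × w ∉ S)
      inM? : U.Decidable InM
      inM? w = (w ≟ x) ⊎-dec (iso? w ×-dec arc? T x w ×-dec ¬? (w ∈? S))
      M : Subset n
      M = comprehension inM?
      M⁺ : ∀ {w} → InM w → w ∈ M
      M⁺ = ∈-comprehension⁺ inM?
      M⁻ : ∀ {w} → w ∈ M → InM w
      M⁻ = ∈-comprehension⁻ inM?
      M⊆V : M ⊆ T .V
      M⊆V w∈ with M⁻ w∈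
      ... | inj₁ refl         = proj₁ (T .arc⊆V xv)
      ... | inj₂ (_ , xw , _) = proj₂ (T .arc⊆V xw)
      p∉M : p ∉ M
      p∉M p∈M with M⁻ p∈M | ∈-comprehension⁻ out? p∈
      ... | inj₁ refl     | xx , _  = T .irrefl xx
      ... | inj₂ (ip , _) | _ , ¬ip = ¬ip ip
      into-x : ∀ {u m} → u ∉ M → m ∈ M → T .A u m → T .A u x
      into-x {u} {m} u∉ m∈ um with M⁻ m∈
      ... | inj₁ refl = um
      ... | inj₂ (im , xm , m∉S) with arc-total T (proj₁ (T .arc⊆V um)) (proj₁ (T .arc⊆V xv))
                                         (λ { refl → u∉ (M⁺ (inj₁ refl)) })
      ...   | inj₁ ux = ux
      -- If `x → u`, then `u` is in `S`: an isolated `u` because it is not in `M`, any other because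
      -- it belongs to `X⁻ₒ`. The arc `u → m` would then put `m` into `S`.
      ...   | inj₂ xu with u ∈? S
      ...     | yes u∈S =
        ⊥-elim (m∉S (closed u∈S (to-x (arc∈V-x (inj₁ xu)) (proj₁ im) um , im)))
      ...     | no u∉S with iso? u
      ...       | yes iu = ⊥-elim (u∉ (M⁺ (inj₂ (iu , xu , u∉S))))
      ...       | no ¬iu = ⊥-elim (u∉S (X⁻⊆S (∈-comprehension⁺ out? (xu , ¬iu))))
      out : ∀ {u m k} → u ∈ T .V → u ∉ M → m ∈ M → k ∈ M → T .A u m → T .A u k
      out _ u∉ m∈ k∈ um with M⁻ k∈
      ... | inj₁ refl          = into-x u∉ m∈ um
      ... | inj₂ (ik , xk , _) = opposite (into-x u∉ m∈ um) xk (inj₂ ik)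

-- Three-element sets through a given vertex

∣p∣≡1+k⇒nonempty : ∀ {k} (p : Subset n) → ∣ p ∣ ≡ suc k → Nonempty p
∣p∣≡1+k⇒nonempty {n = n} p eq with nonempty? p
... | yes v    = v
... | no empty = contradiction
  (trans (sym eq) (trans (cong ∣_∣ (Empty-unique empty)) (∣⊥∣≡0 n))) λ ()

remove-element : ∀ {k x} (p : Subset n) → ∣ p ∣ ≡ suc k → x ∈ p →
                 p ≡ ⁅ x ⁆ ∪ (p - x) × ∣ p - x ∣ ≡ k
remove-element {x = x} p eq x∈ = p≡ ,
  suc-injective (trans (sym (∣⁅x⁆∪p∣≡1+∣p∣ (p - x) (λ x∈p-x → x∈p-y⇒x≢y p x∈p-x refl)))
                       (trans (cong ∣_∣ (sym p≡)) eq))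
  where
  ⊆₁ : p ⊆ ⁅ x ⁆ ∪ (p - x)
  ⊆₁ {v} v∈ with v ≟ x
  ... | yes refl = x∈p∪q⁺ (inj₁ (x∈⁅x⁆ x))
  ... | no v≢x   = x∈p∪q⁺ (inj₂ (x∈p∧x≢y⇒x∈p-y v∈ v≢x))
  ⊆₂ : ⁅ x ⁆ ∪ (p - x) ⊆ p
  ⊆₂ v∈ with x∈p∪q⁻ ⁅ x ⁆ (p - x) v∈
  ... | inj₂ v∈p-x = p─q⊆p p ⁅ x ⁆ v∈p-x
  ... | inj₁ v∈x with x∈⁅y⁆⇒x≡y x v∈x
  ...   | refl = x∈
  p≡ : p ≡ ⁅ x ⁆ ∪ (p - x)
  p≡ = ⊆-antisym ⊆₁ ⊆₂

∣e∣≡3⇒triple : ∀ {x} (e : Subset n) → ∣ e ∣ ≡ 3 → x ∈ e →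
               ∃[ v ] ∃[ w ] x ≢ v × x ≢ w × v ≢ w × e ≡ triple x v w
∣e∣≡3⇒triple {x = x} e eq x∈ with remove-element e eq x∈
... | e≡ , eq₂ with ∣p∣≡1+k⇒nonempty (e - x) eq₂
...   | v , v∈ with remove-element (e - x) eq₂ v∈
...     | e-x≡ , eq₁ with ∣p∣≡1+k⇒nonempty (e - x - v) eq₁
...       | w , w∈ with remove-element (e - x - v) eq₁ w∈
...         | e-x-v≡ , eq₀ =
  v , w , x∈p-y⇒x≢y e v∈ ∘ sym , x∈p-y⇒x≢y e (p─q⊆p (e - x) ⁅ v ⁆ w∈) ∘ sym ,
  x∈p-y⇒x≢y (e - x) w∈ ∘ sym ,
  trans e≡ (cong (⁅ x ⁆ ∪_) (trans e-x≡ (cong (⁅ v ⁆ ∪_) e-x-v≡w)))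
  where
  e-x-v≡w : e - x - v ≡ ⁅ w ⁆
  e-x-v≡w = ⊆-antisym ⊆w (λ u∈ → subst (_∈ e - x - v) (sym (x∈⁅y⁆⇒x≡y w u∈)) w∈)
    where
    ⊆w : e - x - v ⊆ ⁅ w ⁆
    ⊆w {u} u∈ with u ≟ w
    ... | yes refl = x∈⁅x⁆ w
    ... | no u≢w   = contradiction
      (subst (∣ e - x - v - w - u ∣ <_) eq₀ (x∈p⇒∣p-x∣<∣p∣ (x∈p∧x≢y⇒x∈p-y u∈ u≢w))) λ ()

-- Necessity of (M1) and (M2)

module Necessity (H : Hypergraph n) (prime : Prime H) (x : Fin n) (x∈ : x ∈ H .V)
  {Tₓ T : Tournament n} (r : Link.Restriction H x Tₓ T) where

  open Link H x
  open Conditions H x Tₓ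
  open Restriction r
  module R = Restricted x∈ r
  module Rᵒᵖ = Restricted x∈ (restriction-dual r)

  X⁻ X⁺ : Subset n
  X⁻ = R.X⁻ₒ
  X⁺ = Rᵒᵖ.X⁻ₒ

  X⁻-in : ∀ {v} → v ∈ X⁻ → T .A x v × ¬ Iso v
  X⁻-in = ∈-comprehension⁻ R.out?

  X⁺-in : ∀ {v} → v ∈ X⁺ → T .A v x × ¬ Iso v
  X⁺-in = ∈-comprehension⁻ Rᵒᵖ.out?

  X⁻-mk : ∀ {v} → T .A x v → ¬ Iso v → v ∈ X⁻
  X⁻-mk xv ¬iv = ∈-comprehension⁺ R.out? (xv , ¬iv)

  X⁺-mk : ∀ {v} → T .A v x → ¬ Iso v → v ∈ X⁺
  X⁺-mk vx ¬iv = ∈-comprehension⁺ Rᵒᵖ.out? (vx , ¬iv)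

  -- An edge of `Gₓ` comes from a 3-cycle that leaves `x` towards one end and returns to `x` from
  -- the other.
  adj-sides : ∀ {v w} → Adj v w → (v ∈ X⁻ × w ∈ X⁺) ⊎ (v ∈ X⁺ × w ∈ X⁻)
  adj-sides vw with R.adj⇒cycle vw
  ... | inj₁ (xv , _ , wx) =
    inj₁ (X⁻-mk xv (adj⇒¬iso vw) , X⁺-mk wx (adj⇒¬iso (symmetric vw)))
  ... | inj₂ (xw , _ , vx) =
    inj₂ (X⁺-mk vx (adj⇒¬iso vw) , X⁻-mk xw (adj⇒¬iso (symmetric vw)))

  disjoint : ∀ {v} → v ∈ X⁻ → v ∉ X⁺
  disjoint v∈⁻ v∈⁺ = arc-asym T (proj₁ (X⁻-in v∈⁻)) (proj₁ (X⁺-in v∈⁺))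

  -- By primality `x` lies in an edge of `H`; this makes both blocks of the bipartition nonempty.
  link-edge : ∃₂ Adj
  link-edge with any? (λ v → any? (adj? v))
  ... | yes found = found
  ... | no none = ⊥-elim (prime-covered {K = H} prime x∈ missed)
    where
    missed : ∀ {e} → H .E e → x ∉ e
    missed e∈ x∈e with CyclesOf.edge⇒cycle cycles e∈
    ... | a , b , c , cyc , refl with ∈triple⁻ x∈e
    ...   | inj₁ refl        = none (_ , _ , R.cycle⇒adj cyc)
    ...   | inj₂ (inj₁ refl) = none (_ , _ , R.cycle⇒adj (rotate T cyc))
    ...   | inj₂ (inj₂ refl) = none (_ , _ , R.cycle⇒adj (rotate T (rotate T cyc)))

  both-nonempty : Nonempty X⁻ × Nonempty X⁺
  both-nonempty with link-edge
  ... | v , w , vw with adj-sides vw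
  ...   | inj₁ (v∈ , w∈) = (v , v∈) , (w , w∈)
  ...   | inj₂ (v∈ , w∈) = (w , w∈) , (v , v∈)

  m1 : M1 X⁻ X⁺
  m1 = (proj₁ both-nonempty , proj₂ both-nonempty
       , (λ (_ , v∈) → let v∈⁻ , v∈⁺ = x∈p∩q⁻ X⁻ X⁺ v∈ in disjoint v∈⁻ v∈⁺)
       , (λ v∈ → [ side⁻ , side⁺ ]′ (x∈p∪q⁻ X⁻ X⁺ v∈))
       , λ (v∈ , ¬iv) → x∈p∪q⁺ (Sum.map (λ xv → X⁻-mk xv ¬iv) (λ vx → X⁺-mk vx ¬iv) (R.at-x v∈)))
     , bipartite
     , λ v⁻ v⁺ v⁻∈ v⁺∈ → mk⇔ (to v⁻∈ v⁺∈)
         (λ vw → R.cycle⇒adj (proj₁ (X⁻-in v⁻∈) , from-x vw , proj₁ (X⁺-in v⁺∈)))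
    where
    side⁻ : ∀ {v} → v ∈ X⁻ → v ∈ V-x × ¬ Iso v
    side⁻ v∈ = R.arc∈V-x (inj₁ (proj₁ (X⁻-in v∈))) , proj₂ (X⁻-in v∈)
    side⁺ : ∀ {v} → v ∈ X⁺ → v ∈ V-x × ¬ Iso v
    side⁺ v∈ = R.arc∈V-x (inj₂ (proj₁ (X⁺-in v∈))) , proj₂ (X⁺-in v∈)
    to : ∀ {v w} → v ∈ X⁻ → w ∈ X⁺ → Adj v w → Tₓ .A v w
    to v∈ w∈ adj@((v∈V , w∈V) , _) with R.adj⇒cycle adj
    ... | inj₁ (_ , vw , _) = to-x v∈V w∈V vw
    ... | inj₂ (xw , _ , _) = ⊥-elim (arc-asym T xw (proj₁ (X⁺-in w∈)))
    bipartite : ∀ C (C⊆V : C ⊆ Graph.V Gₓ) → IsComponent Gₓ C C⊆V → 2 ≤ ∣ C ∣ →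
                IsBipartiteWith (inducedᴳ Gₓ C C⊆V) (X⁻ ∩ C) (X⁺ ∩ C)
    bipartite C C⊆V isC 2≤ =
      ( proj₁ nonempty , proj₂ nonempty
      , (λ (_ , v∈) → let v∈⁻ , v∈⁺ = x∈p∩q⁻ (X⁻ ∩ C) (X⁺ ∩ C) v∈ in
           disjoint (proj₁ (x∈p∩q⁻ X⁻ C v∈⁻)) (proj₁ (x∈p∩q⁻ X⁺ C v∈⁺)))
      , (λ v∈ → [ proj₂ ∘ x∈p∩q⁻ X⁻ C , proj₂ ∘ x∈p∩q⁻ X⁺ C ]′ (x∈p∪q⁻ (X⁻ ∩ C) (X⁺ ∩ C) v∈))
      , covered )
      , (λ v w v∈ w∈ (vw , _) →
           no-adj⁻ (proj₁ (x∈p∩q⁻ X⁻ C v∈)) (proj₁ (x∈p∩q⁻ X⁻ C w∈)) vw)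
      , (λ v w v∈ w∈ (vw , _) →
           no-adj⁺ (proj₁ (x∈p∩q⁻ X⁺ C v∈)) (proj₁ (x∈p∩q⁻ X⁺ C w∈)) vw)
      where
      no-adj⁻ : ∀ {v w} → v ∈ X⁻ → w ∈ X⁻ → ¬ Adj v w
      no-adj⁻ v∈ w∈ vw = [ disjoint w∈ ∘ proj₂ , disjoint v∈ ∘ proj₁ ]′ (adj-sides vw)
      no-adj⁺ : ∀ {v w} → v ∈ X⁺ → w ∈ X⁺ → ¬ Adj v w
      no-adj⁺ v∈ w∈ vw =
        [ (λ (v∈⁻ , _) → disjoint v∈⁻ v∈) , (λ (_ , w∈⁻) → disjoint w∈⁻ w∈) ]′ (adj-sides vw)
      adjacent : ∀ {v} → v ∈ C → ∃[ w ] w ∈ C × Adj v w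
      adjacent v∈ with component-neighbour Gₓ C C⊆V isC 2≤ v∈
      ... | w , w∈ , vw = w , w∈ , vw
      nonempty : Nonempty (X⁻ ∩ C) × Nonempty (X⁺ ∩ C)
      nonempty with proj₁ (proj₁ isC)
      ... | v , v∈ with adjacent v∈
      ...   | w , w∈ , vw with adj-sides vw
      ...     | inj₁ (v∈⁻ , w∈⁺) = (v , x∈p∩q⁺ (v∈⁻ , v∈)) , (w , x∈p∩q⁺ (w∈⁺ , w∈))
      ...     | inj₂ (v∈⁺ , w∈⁻) = (w , x∈p∩q⁺ (w∈⁻ , w∈)) , (v , x∈p∩q⁺ (v∈⁺ , v∈))
      covered : ∀ {v} → v ∈ C → v ∈ (X⁻ ∩ C) ∪ (X⁺ ∩ C)
      covered v∈ with adjacent v∈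
      ... | w , w∈ , vw with adj-sides vw
      ...   | inj₁ (v∈⁻ , _) = x∈p∪q⁺ (inj₁ (x∈p∩q⁺ (v∈⁻ , v∈)))
      ...   | inj₂ (v∈⁺ , _) = x∈p∪q⁺ (inj₂ (x∈p∩q⁺ (v∈⁺ , v∈)))

  y⁻-out : ∀ {v} → Y⁻ X⁻ v → T .A x v
  y⁻-out = R.Y⁻-out (proj₁ ∘ X⁻-in)

  y⁺-in : ∀ {v} → Y⁺ X⁺ v → T .A v x
  y⁺-in = Rᵒᵖ.Y⁻-out (proj₁ ∘ X⁺-in)

  m2 : M2 X⁻ X⁺
  m2 = (λ v (y⁻ , y⁺) → arc-asym T (y⁻-out y⁻) (y⁺-in y⁺))
     , ((λ { (inj₁ y⁻) → proj₁ y⁻ ; (inj₂ y⁺) → proj₁ y⁺ })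
       -- The direction of the arc between `x` and an isolated vertex decides between `Y⁻` and `Y⁺`;
       -- the second case is the first one in the reversed tournaments.
       , λ iv → Sum.map
           (R.out⇒Y⁻ (prime⇒tprime cycles prime) (proj₁ both-nonempty) iv)
           (Rᵒᵖ.out⇒Y⁻ (prime⇒tprime (dual-cycles cycles) prime) (proj₂ both-nonempty) iv)
           (R.at-x (proj₁ iv)))
     , (λ y⁺ x⁻∈ → R.oppositeₓ (y⁺-in y⁺) (proj₁ (X⁻-in x⁻∈)) (inj₁ (proj₁ y⁺)))
     , (λ x⁺∈ y⁻ → R.oppositeₓ (proj₁ (X⁺-in x⁺∈)) (y⁻-out y⁻) (inj₂ (proj₁ y⁻)))
     , (λ y⁺ y⁻ → R.oppositeₓ (y⁺-in y⁺) (y⁻-out y⁻) (inj₁ (proj₁ y⁺)))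

-- Sufficiency, and the arcs that are forced at `x`

module Bipartitioned (H : Hypergraph n) (x : Fin n) (x∈ : x ∈ H .V) (Tₓ : Tournament n)
  {X⁻ X⁺ : Subset n} (m1 : Conditions.M1 H x Tₓ X⁻ X⁺) (m2 : Conditions.M2 H x Tₓ X⁻ X⁺) where

  open Link H x
  open Conditions H x Tₓ

  X⁻⊆ : ∀ {v} → v ∈ X⁻ → v ∈ V-x × ¬ Iso v
  X⁻⊆ v∈ = proj₁ (proj₂ (proj₂ (proj₂ (proj₁ m1)))) (x∈p∪q⁺ (inj₁ v∈))

  X⁺⊆ : ∀ {v} → v ∈ X⁺ → v ∈ V-x × ¬ Iso v
  X⁺⊆ v∈ = proj₁ (proj₂ (proj₂ (proj₂ (proj₁ m1)))) (x∈p∪q⁺ (inj₂ v∈))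

  X-cover : ∀ {v} → v ∈ V-x → ¬ Iso v → v ∈ X⁻ ⊎ v ∈ X⁺
  X-cover v∈ ¬iv = x∈p∪q⁻ X⁻ X⁺ (proj₂ (proj₂ (proj₂ (proj₂ (proj₁ m1)))) (v∈ , ¬iv))

  X-disjoint : ∀ {v} → v ∈ X⁻ → v ∉ X⁺
  X-disjoint v∈⁻ v∈⁺ = proj₁ (proj₂ (proj₂ (proj₁ m1))) (_ , x∈p∩q⁺ (v∈⁻ , v∈⁺))

  -- (M1) speaks of components with at least two vertices; the component of `v` contains `w` as
  -- well, so it is one of these.
  no-adj : ∀ {v w} → Adj v w → ¬ (v ∈ X⁻ × w ∈ X⁻) × ¬ (v ∈ X⁺ × w ∈ X⁺)
  no-adj {v} {w} vw@((v∈ , _) , v≢w , _) with component-of (link H x) adj? v∈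
  ... | C , C⊆V , isC , v∈C , closed =
      (λ (v∈⁻ , w∈⁻) → proj₁ independent v w (x∈p∩q⁺ (v∈⁻ , v∈C)) (x∈p∩q⁺ (w∈⁻ , w∈C)) vw′)
    , (λ (v∈⁺ , w∈⁺) → proj₂ independent v w (x∈p∩q⁺ (v∈⁺ , v∈C)) (x∈p∩q⁺ (w∈⁺ , w∈C)) vw′)
    where
    w∈C : w ∈ C
    w∈C = closed v∈C vw
    vw′ : Graph.Adj (inducedᴳ (link H x) C C⊆V) v w
    vw′ = vw , v∈C , w∈C
    vw⊆C : ⁅ v ⁆ ∪ ⁅ w ⁆ ⊆ C
    vw⊆C u∈ with x∈p∪q⁻ ⁅ v ⁆ ⁅ w ⁆ u∈
    ... | inj₁ u∈v = subst (_∈ C) (sym (x∈⁅y⁆⇒x≡y v u∈v)) v∈C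
    ... | inj₂ u∈w = subst (_∈ C) (sym (x∈⁅y⁆⇒x≡y w u∈w)) w∈C
    independent = proj₂ (proj₁ (proj₂ m1) C C⊆V isC
      (subst (_≤ ∣ C ∣) (∣⁅x⁆∪⁅y⁆∣≡2 v≢w) (p⊆q⇒∣p∣≤∣q∣ vw⊆C)))

  -- These are to be the out- and in-neighbours of `x`; (M1) and (M2) make them a partition of
  -- `V-x`.
  Out In : Pred (Fin n) 0ℓ
  Out v = v ∈ X⁻ ⊎ Y⁻ X⁻ v
  In v = v ∈ X⁺ ⊎ Y⁺ X⁺ v

  out∈V-x : ∀ {v} → Out v → v ∈ V-x
  out∈V-x (inj₁ v∈) = proj₁ (X⁻⊆ v∈)
  out∈V-x (inj₂ y)  = proj₁ (proj₁ y)

  in∈V-x : ∀ {v} → In v → v ∈ V-x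
  in∈V-x (inj₁ v∈) = proj₁ (X⁺⊆ v∈)
  in∈V-x (inj₂ y)  = proj₁ (proj₁ y)

  out⊎in : ∀ {v} → v ∈ V-x → Out v ⊎ In v
  out⊎in {v} v∈ with iso? v
  ... | yes iv = Sum.map inj₂ inj₂ (proj₂ (proj₁ (proj₂ m2)) iv)
  ... | no ¬iv = Sum.map inj₁ inj₁ (X-cover v∈ ¬iv)

  out∩in : ∀ {v} → Out v → ¬ In v
  out∩in (inj₁ v∈⁻) (inj₁ v∈⁺) = X-disjoint v∈⁻ v∈⁺
  out∩in (inj₁ v∈⁻) (inj₂ y⁺)  = proj₂ (X⁻⊆ v∈⁻) (proj₁ y⁺)
  out∩in (inj₂ y⁻)  (inj₁ v∈⁺) = proj₂ (X⁺⊆ v∈⁺) (proj₁ y⁻)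
  out∩in (inj₂ y⁻)  (inj₂ y⁺)  = proj₁ m2 _ (y⁻ , y⁺)

  -- Of the four kinds of pairs between `Out` and `In`, (M2) orients three the other way; on the
  -- remaining kind (M1) identifies arcs with edges of `Gₓ`.
  arc⇒adj : ∀ {v w} → Out v → In w → Tₓ .A v w → Adj v w
  arc⇒adj (inj₁ v∈) (inj₁ w∈) vw = Equivalence.from (proj₂ (proj₂ m1) _ _ v∈ w∈) vw
  arc⇒adj (inj₁ v∈) (inj₂ y⁺) vw = ⊥-elim (arc-asym Tₓ vw (proj₁ (proj₂ (proj₂ m2)) y⁺ v∈))
  arc⇒adj (inj₂ y⁻) (inj₁ w∈) vw = ⊥-elim (arc-asym Tₓ vw (proj₁ (proj₂ (proj₂ (proj₂ m2))) w∈ y⁻))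
  arc⇒adj (inj₂ y⁻) (inj₂ y⁺) vw = ⊥-elim (arc-asym Tₓ vw (proj₂ (proj₂ (proj₂ (proj₂ m2))) y⁺ y⁻))

  OutInArc : Rel (Fin n) 0ℓ
  OutInArc v w = v ∈ X⁻ × w ∈ X⁺ × Tₓ .A v w

  adj-sides : ∀ {v w} → Adj v w → OutInArc v w ⊎ OutInArc w v
  adj-sides {v} {w} vw@((v∈ , w∈) , _)
    with X-cover v∈ (adj⇒¬iso vw) | X-cover w∈ (adj⇒¬iso (symmetric vw))
  ... | inj₁ v∈⁻ | inj₁ w∈⁻ = ⊥-elim (proj₁ (no-adj vw) (v∈⁻ , w∈⁻))
  ... | inj₂ v∈⁺ | inj₂ w∈⁺ = ⊥-elim (proj₂ (no-adj vw) (v∈⁺ , w∈⁺))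
  ... | inj₁ v∈⁻ | inj₂ w∈⁺ =
    inj₁ (v∈⁻ , w∈⁺ , Equivalence.to (proj₂ (proj₂ m1) _ _ v∈⁻ w∈⁺) vw)
  ... | inj₂ v∈⁺ | inj₁ w∈⁻ =
    inj₂ (w∈⁻ , v∈⁺ , Equivalence.to (proj₂ (proj₂ m1) _ _ w∈⁻ v∈⁺) (symmetric vw))

  -- A vertex of `X⁻` has a neighbour in `Gₓ`, necessarily in `X⁺`, and the arc of `Tₓ` between them
  -- fixes the orientation of their 3-cycle through `x`. From the blocks the direction spreads along
  -- the sequences defining `Y⁻` and `Y⁺`.
  arcs-at : ∀ {T} → Restriction Tₓ T → ArcsAt X⁻ X⁺ T
  arcs-at {T} r = x⁻-out , x⁺-in
                , Restricted.Y⁻-out x∈ r x⁻-out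
                , Restricted.Y⁻-out x∈ (restriction-dual r) x⁺-in
    where
    open Restriction r
    open Restricted x∈ r using (adj⇒cycle)
    at-edge : ∀ {v w} → Adj v w → Tₓ .A v w → T .A x v × T .A w x
    at-edge vw v→w with adj⇒cycle vw
    ... | inj₁ (xv , _ , wx) = xv , wx
    ... | inj₂ (_ , w→v , _) = ⊥-elim (arc-asym T (from-x v→w) w→v)
    x⁻-out : ∀ {v} → v ∈ X⁻ → T .A x v
    x⁻-out v∈ with neighbour (proj₁ (X⁻⊆ v∈)) (proj₂ (X⁻⊆ v∈))
    ... | w , vw with adj-sides vw
    ...   | inj₁ (_ , _ , v→w)  = proj₁ (at-edge vw v→w)
    ...   | inj₂ (_ , v∈⁺ , _) = ⊥-elim (X-disjoint v∈ v∈⁺)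
    x⁺-in : ∀ {v} → v ∈ X⁺ → T .A v x
    x⁺-in v∈ with neighbour (proj₁ (X⁺⊆ v∈)) (proj₂ (X⁺⊆ v∈))
    ... | w , vw with adj-sides vw
    ...   | inj₁ (v∈⁻ , _ , _) = ⊥-elim (X-disjoint v∈⁻ v∈)
    ...   | inj₂ (_ , _ , w→v)  = proj₂ (at-edge (symmetric vw) w→v)

  restriction-⊆ : ∀ {T S} → Restriction Tₓ T → Restriction Tₓ S →
                  ∀ {u v} → T .A u v → S .A u v
  restriction-⊆ {T} {S} rT rS {u} {v} uv with u ≟ x | v ≟ x
  ... | yes refl | _ with out⊎in (Restricted.arc∈V-x x∈ rT (inj₁ uv)) | arcs-at rT | arcs-at rS
  ...   | inj₁ o | _ | x⁻ , _ , y⁻ , _ = [ x⁻ , y⁻ ]′ o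
  ...   | inj₂ i | _ , x⁺ , _ , y⁺ | _ = ⊥-elim (arc-asym T uv ([ x⁺ , y⁺ ]′ i))
  restriction-⊆ {T} {S} rT rS {u} {v} uv | no _ | yes refl
    with out⊎in (Restricted.arc∈V-x x∈ rT (inj₂ uv)) | arcs-at rT | arcs-at rS
  ...   | inj₁ o | x⁻ , _ , y⁻ , _ | _ = ⊥-elim (arc-asym T uv ([ x⁻ , y⁻ ]′ o))
  ...   | inj₂ i | _ | _ , x⁺ , _ , y⁺ = [ x⁺ , y⁺ ]′ i
  restriction-⊆ {T} {S} rT rS {u} {v} uv | no u≢x | no v≢x =
    Restriction.from-x rS (Restriction.to-x rT (∈V-x (proj₁ (T .arc⊆V uv)) u≢x)
                                               (∈V-x (proj₂ (T .arc⊆V uv)) v≢x) uv)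
    where
    ∈V-x : ∀ {w} → w ∈ T .V → w ≢ x → w ∈ V-x
    ∈V-x w∈ = x∈p∧x≢y⇒x∈p-y (subst (_ ∈_) (CyclesOf.V≡ (Restriction.cycles rT)) w∈)

  module _ (Rₓ : CyclesOf Tₓ (H -ᴴ x)) where

    -- As `x` is not a vertex of `Tₓ` and lies in neither `Out` nor `In`, the three alternatives
    -- exclude one another.
    Arc : Rel (Fin n) 0ℓ
    Arc v w = Tₓ .A v w ⊎ (v ≡ x × Out w) ⊎ (w ≡ x × In v)

    V-x⊆V : ∀ {v} → v ∈ V-x → v ∈ H .V
    V-x⊆V = p─q⊆p (H .V) ⁅ x ⁆

    Tₓ-arc : ∀ {v w} → Tₓ .A v w → v ∈ V-x × w ∈ V-x
    Tₓ-arc vw = subst (_ ∈_) (CyclesOf.V≡ Rₓ) (proj₁ (Tₓ .arc⊆V vw))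
              , subst (_ ∈_) (CyclesOf.V≡ Rₓ) (proj₂ (Tₓ .arc⊆V vw))

    from-x⁻ : ∀ {w} → Arc x w → Out w
    from-x⁻ (inj₁ xw)               = ⊥-elim (x∉V-x (proj₁ (Tₓ-arc xw)))
    from-x⁻ (inj₂ (inj₁ (_ , o)))   = o
    from-x⁻ (inj₂ (inj₂ (_ , i)))   = ⊥-elim (x∉V-x (in∈V-x i))

    to-x⁻ : ∀ {w} → Arc w x → In w
    to-x⁻ (inj₁ wx)               = ⊥-elim (x∉V-x (proj₂ (Tₓ-arc wx)))
    to-x⁻ (inj₂ (inj₁ (_ , o)))   = ⊥-elim (x∉V-x (out∈V-x o))
    to-x⁻ (inj₂ (inj₂ (_ , i)))   = i

    arc-off-x : ∀ {v w} → v ≢ x → w ≢ x → Arc v w → Tₓ .A v w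
    arc-off-x _   _   (inj₁ vw)                = vw
    arc-off-x v≢x _   (inj₂ (inj₁ (refl , _))) = ⊥-elim (v≢x refl)
    arc-off-x _   w≢x (inj₂ (inj₂ (refl , _))) = ⊥-elim (w≢x refl)

    extension : Tournament n
    extension = record
      { V          = H .V
      ; A          = Arc
      ; arc⊆V      = λ
          { (inj₁ vw)                → V-x⊆V (proj₁ (Tₓ-arc vw)) , V-x⊆V (proj₂ (Tₓ-arc vw))
          ; (inj₂ (inj₁ (refl , o))) → x∈ , V-x⊆V (out∈V-x o)
          ; (inj₂ (inj₂ (refl , i))) → V-x⊆V (in∈V-x i) , x∈
          }
      ; irrefl     = λ
          { (inj₁ vv)                → Tₓ .irrefl vv
          ; (inj₂ (inj₁ (refl , o))) → x∉V-x (out∈V-x o)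
          ; (inj₂ (inj₂ (refl , i))) → x∉V-x (in∈V-x i)
          }
      ; exactlyOne = one
      }
      where
      one : ∀ {v w} → v ∈ H .V → w ∈ H .V → v ≢ w →
            (Arc v w × ¬ Arc w v) ⊎ (Arc w v × ¬ Arc v w)
      one {v} {w} v∈ w∈ v≢w with v ≟ x | w ≟ x
      ... | yes refl | yes refl = ⊥-elim (v≢w refl)
      ... | yes refl | no w≢x with out⊎in (x∈p∧x≢y⇒x∈p-y w∈ w≢x)
      ...   | inj₁ o = inj₁ (inj₂ (inj₁ (refl , o)) , out∩in o ∘ to-x⁻)
      ...   | inj₂ i = inj₂ (inj₂ (inj₂ (refl , i)) , λ xw → out∩in (from-x⁻ xw) i)
      one {v} {w} v∈ w∈ v≢w | no v≢x | yes refl with out⊎in (x∈p∧x≢y⇒x∈p-y v∈ v≢x)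
      ...   | inj₁ o = inj₂ (inj₂ (inj₁ (refl , o)) , out∩in o ∘ to-x⁻)
      ...   | inj₂ i = inj₁ (inj₂ (inj₂ (refl , i)) , λ xv → out∩in (from-x⁻ xv) i)
      one {v} {w} v∈ w∈ v≢w | no v≢x | no w≢x
        with Tₓ .exactlyOne (subst (_ ∈_) (sym (CyclesOf.V≡ Rₓ)) (x∈p∧x≢y⇒x∈p-y v∈ v≢x))
                            (subst (_ ∈_) (sym (CyclesOf.V≡ Rₓ)) (x∈p∧x≢y⇒x∈p-y w∈ w≢x)) v≢w
      ...   | inj₁ (vw , ¬wv) = inj₁ (inj₁ vw , ¬wv ∘ arc-off-x w≢x v≢x)
      ...   | inj₂ (wv , ¬vw) = inj₂ (inj₁ wv , ¬vw ∘ arc-off-x v≢x w≢x)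

    cycle-at-x : ∀ {v w} → Cycle extension x v w → H .E (triple x v w)
    cycle-at-x {v} {w} (xv , vw , wx) =
      proj₂ (proj₂ (arc⇒adj o i (arc-off-x (off (out∈V-x o)) (off (in∈V-x i)) vw)))
      where
      o : Out v
      o = from-x⁻ xv
      i : In w
      i = to-x⁻ wx
      off : ∀ {u} → u ∈ V-x → u ≢ x
      off = x∈p-y⇒x≢y (H .V)

    extension-cycles : CyclesOf extension H
    extension-cycles = record { V≡ = refl ; edge⇒cycle = edge⇒cycle ; cycle⇒edge = cycle⇒edge }
      where
      edge⇒cycle : ∀ {e} → H .E e → ∃[ a ] ∃[ b ] ∃[ c ] Cycle extension a b c × e ≡ triple a b c
      edge⇒cycle {e} e∈ with x ∈? e
      ... | no x∉ with CyclesOf.edge⇒cycle Rₓ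
                         (e∈ , λ v∈ → x∈p∧x≢y⇒x∈p-y (H .edge⊆V e∈ v∈) (λ { refl → x∉ v∈ }))
      ...   | a , b , c , (ab , bc , ca) , eq = a , b , c , (inj₁ ab , inj₁ bc , inj₁ ca) , eq
      edge⇒cycle {e} e∈ | yes x∈e with ∣e∣≡3⇒triple e (H .uniform e∈) x∈e
      ... | v , w , x≢v , x≢w , v≢w , refl with adj-sides
              (( x∈p∧x≢y⇒x∈p-y (H .edge⊆V e∈ triple-2nd) (x≢v ∘ sym)
               , x∈p∧x≢y⇒x∈p-y (H .edge⊆V e∈ triple-3rd) (x≢w ∘ sym)) , v≢w , e∈)
      ...   | inj₁ (v∈⁻ , w∈⁺ , vw) =
        x , v , w , (inj₂ (inj₁ (refl , inj₁ v∈⁻)) , inj₁ vw , inj₂ (inj₂ (refl , inj₁ w∈⁺))) , refl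
      ...   | inj₂ (w∈⁻ , v∈⁺ , wv) =
        x , w , v , (inj₂ (inj₁ (refl , inj₁ w∈⁻)) , inj₁ wv , inj₂ (inj₂ (refl , inj₁ v∈⁺)))
          , triple-swap x v w
      cycle⇒edge : ∀ {a b c} → Cycle extension a b c → H .E (triple a b c)
      cycle⇒edge {a} {b} {c} cyc@(ab , bc , ca) with a ≟ x | b ≟ x | c ≟ x
      ... | yes refl | _        | _        = cycle-at-x cyc
      ... | _        | yes refl | _        =
        subst (H .E) (sym (triple-rotate a b c)) (cycle-at-x (rotate extension cyc))
      ... | _        | _        | yes refl =
        subst (H .E) (triple-rotate c a b) (cycle-at-x (rotate extension (rotate extension cyc)))
      ... | no a≢x   | no b≢x   | no c≢x   =
        proj₁ (CyclesOf.cycle⇒edge Rₓ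
          (arc-off-x a≢x b≢x ab , arc-off-x b≢x c≢x bc , arc-off-x c≢x a≢x ca))

-- Deleting `x`, and the conclusion

delete-cycles : {T : Tournament n} {H : Hypergraph n} (x : Fin n) → CyclesOf T H →
                CyclesOf (T -ᵀ x) (H -ᴴ x)
delete-cycles {T = T} {H} x R = record
  { V≡         = cong (_- x) V≡
  ; edge⇒cycle = to
  ; cycle⇒edge = λ ((ab , a∈ , b∈) , (bc , _ , c∈) , (ca , _)) →
      cycle⇒edge (ab , bc , ca) , triple-⊆ (conv a∈) (conv b∈) (conv c∈)
  }
  where
  open CyclesOf R
  conv : ∀ {v} → v ∈ T .V - x → v ∈ H .V - x
  conv = subst (λ W → _ ∈ W - x) V≡
  conv⁻ : ∀ {v} → v ∈ H .V - x → v ∈ T .V - x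
  conv⁻ = subst (λ W → _ ∈ W - x) (sym V≡)
  to : ∀ {e} → (H -ᴴ x) .E e → ∃[ a ] ∃[ b ] ∃[ c ] Cycle (T -ᵀ x) a b c × e ≡ triple a b c
  to (e∈ , e⊆) with edge⇒cycle e∈
  ... | a , b , c , (ab , bc , ca) , refl =
    a , b , c , ((ab , a∈ , b∈) , (bc , b∈ , c∈) , (ca , c∈ , a∈)) , refl
    where
    a∈ = conv⁻ (e⊆ triple-1st)
    b∈ = conv⁻ (e⊆ triple-2nd)
    c∈ = conv⁻ (e⊆ triple-3rd)

-- Rigidity on the prime `H -ᴴ x` compares `T -ᵀ x` with `Tₓ`. If they are dual to each other, the
-- dual of `T` still realizes `H` and restricts to `Tₓ`.
extending-realization : (H : Hypergraph n) (x : Fin n) → Prime (H -ᴴ x) → {Tₓ : Tournament n} →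
  CyclesOf Tₓ (H -ᴴ x) → Realizable H → ∃[ T ] CyclesOf T H × (T -ᵀ x) ≈ᵀ Tₓ
extending-realization H x primeₓ {Tₓ} Rₓ (T , real)
  with rigidity {T = T -ᵀ x} {Tₓ} primeₓ (delete-cycles {T = T} {H} x (realizes⁻ real)) Rₓ
... | inj₁ T-x≈Tₓ            = T , realizes⁻ real , T-x≈Tₓ
... | inj₂ (V≡ , to , from) =
  dual T , dual-cycles {T = T} (realizes⁻ real) , V≡ , (λ (vu , u∈ , v∈) → to (vu , v∈ , u∈))
    , (λ uv → let vu , v∈ , u∈ = from uv in vu , u∈ , v∈)

theorem55 : ∀ {n : ℕ} (H : Hypergraph n) → Prime H → ¬ Critical H →
    (x : Fin n) → x ∈ Hypergraph.V H → Prime (H -ᴴ x) →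
    (Tₓ : Tournament n) → Tₓ Realizes (H -ᴴ x) →
    let open Conditions H x Tₓ in
    (Realizable H ⇔ (∃₂ λ X⁻ X⁺ → M1 X⁻ X⁺ × M2 X⁻ X⁺))
    × (Realizable H → ∃! _≈ᵀ_ (λ T → T Realizes H × (T -ᵀ x) ≈ᵀ Tₓ))
    × (∀ X⁻ X⁺ → M1 X⁻ X⁺ → M2 X⁻ X⁺ →
       ∀ T → T Realizes H → (T -ᵀ x) ≈ᵀ Tₓ → ArcsAt X⁻ X⁺ T)
theorem55 H prime _ x x∈ primeₓ Tₓ realₓ =
  mk⇔ necessary sufficient , unique , arcs
  where
  open Conditions H x Tₓ
  open Link H x using (restriction)
  Rₓ : CyclesOf Tₓ (H -ᴴ x)
  Rₓ = realizes⁻ realₓ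

  necessary : Realizable H → ∃₂ λ X⁻ X⁺ → M1 X⁻ X⁺ × M2 X⁻ X⁺
  necessary real with extending-realization H x primeₓ Rₓ real
  ... | T , R , T-x≈Tₓ = _ , _ , m1 , m2
    where open Necessity H prime x x∈ (restriction {Tₓ} {T} R T-x≈Tₓ)

  sufficient : (∃₂ λ X⁻ X⁺ → M1 X⁻ X⁺ × M2 X⁻ X⁺) → Realizable H
  sufficient (_ , _ , m1 , m2) = extension Rₓ , realizes⁺ (extension-cycles Rₓ)
    where open Bipartitioned H x x∈ Tₓ m1 m2

  unique : Realizable H → ∃! _≈ᵀ_ (λ T → T Realizes H × (T -ᵀ x) ≈ᵀ Tₓ)
  unique real with extending-realization H x primeₓ Rₓ real
  -- The sets obtained from `T` satisfy (M1) and (M2), which fix the arcs at `x` in every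
  -- realization restricting to `Tₓ`, hence also in `S`.
  ... | T , R , T-x≈Tₓ = T , (realizes⁺ R , T-x≈Tₓ) , λ {S} (realS , S-x≈Tₓ) →
    arcs⊆⇒≈ {P = T} {S} (trans (CyclesOf.V≡ R) (sym (proj₁ realS)))
      (restriction-⊆ (restriction {Tₓ} {T} R T-x≈Tₓ) (restriction {T = S} (realizes⁻ realS) S-x≈Tₓ))
    where
    open Necessity H prime x x∈ (restriction {Tₓ} {T} R T-x≈Tₓ) using (m1; m2)
    open Bipartitioned H x x∈ Tₓ m1 m2 using (restriction-⊆)

  arcs : ∀ X⁻ X⁺ → M1 X⁻ X⁺ → M2 X⁻ X⁺ →
         ∀ T → T Realizes H → (T -ᵀ x) ≈ᵀ Tₓ → ArcsAt X⁻ X⁺ T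
  arcs _ _ m1 m2 T real T-x≈Tₓ =
    Bipartitioned.arcs-at H x x∈ Tₓ m1 m2 (restriction {Tₓ} {T} (realizes⁻ real) T-x≈Tₓ)
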